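{- Let $k\in\mathbb N$ and, for $1\le i\le k$, let $q_i\in\mathbb Q_{>0}$, $a_i,b_i\in\mathbb N$ and $n_i,m_i\in\mathbb Z$. Assume that the set of polynomials $$\{x,\ y\}\cup\{q_i(a_ix+n_i)(b_iy+m_i)\mid 1\le i\le k\}$$ has cardinality $k+2\ge 5$ and that the pattern consisting of its elements is partition regular. Then $k=3$ and there is $q\in\mathbb Q_{>0}$ such that the pattern has the form (up to the order of its terms) $$x,\quad y,\quad qxy,\quad qxy+x,\quad qxy+y.$$ Moreover, for $q\in\mathbb Q_{>0}$, the partition regularity of the pattern $x,\ y,\ qxy,\ qxy+x,\ qxy+y$ is equivalent to the partition regularity of the pattern $x,\ y,\ xy,\ xy+x,\ xy+y$.
   Context: $\mathbb N$ denotes the set of positive integers ($0\notin\mathbb N$). A pattern $f_1(x,y),\dots,f_k(x,y)$ (with the $f_i$ rational-valued functions) is called partition regular if, for every finite colouring (partition into finitely many pieces) of $\mathbb N$, the set of monochromatic $k$-tuples $(f_1(u,v),\dots,f_k(u,v))$ with $u,v\in\mathbb N$ is infinite; here a tuple is monochromatic if all its entries belong to $\mathbb N$ and lie in the same colour. -}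

module Defs where

open import Data.Fin.Base using (Fin; toℕ)
open import Data.Fin.Permutation using (Permutation; _⟨$⟩ʳ_)
open import Data.Integer.Base as ℤ using (ℤ; +_)
open import Data.List.Base using (List)
open import Data.List.Membership.Propositional using (_∉_)
open import Data.Nat.Base as ℕ using (ℕ; suc; _∸_; NonZero)
open import Data.Product.Base using (_×_; ∃-syntax; Σ-syntax)
open import Data.Rational.Base using (ℚ; 0ℚ; _/_; _+_; _*_)
open import Data.Rational.Properties using (+-0-commutativeMonoid)
open import Data.Vec.Base using (Vec; []; _∷_; map; lookup; tabulate)
open import Data.Vec.Relation.Unary.All using (All)
open import Data.Vec.Relation.Unary.Any using (Any)
open import Function.Bundles using (_⇔_)
open import Function.Definitions using (Injective)
open import Relation.Binary.PropositionalEquality.Core using (_≡_)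
open import Relation.Unary using (Pred)
open import Level using (0ℓ)

open import Algebra.Properties.CommutativeMonoid.Sum +-0-commutativeMonoid using (sum)

fromℤ : ℤ → ℚ
fromℤ z = z / 1

fromℕ : ℕ → ℚ
fromℕ n = fromℤ (+ n)

infixl 6 _⊕_
infixl 7 _⊗_
infix  4 _≈_

-- Elements of ℚ[x,y], presented by expressions. Two expressions denote the
-- same polynomial when all their coefficients agree (_≈_ below).
data Poly : Set where
  con     : ℚ → Poly
  X Y     : Poly
  _⊕_ _⊗_ : Poly → Poly → Poly

-- coeff p i j is the coefficient of xⁱyʲ in p.
coeff : Poly → ℕ → ℕ → ℚ
coeff (con c) 0 0 = c
coeff (con c) _ _ = 0ℚ
coeff X       1 0 = fromℕ 1
coeff X       _ _ = 0ℚ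
coeff Y       0 1 = fromℕ 1
coeff Y       _ _ = 0ℚ
coeff (p ⊕ q) i j = coeff p i j + coeff q i j
coeff (p ⊗ q) i j =
  sum {suc i} λ s → sum {suc j} λ t →
    coeff p (toℕ s) (toℕ t) * coeff q (i ∸ toℕ s) (j ∸ toℕ t)

_≈_ : Poly → Poly → Set
p ≈ q = ∀ i j → coeff p i j ≡ coeff q i j

eval : Poly → ℚ → ℚ → ℚ
eval (con c) x y = c
eval X       x y = x
eval Y       x y = y
eval (p ⊕ q) x y = eval p x y + eval q x y
eval (p ⊗ q) x y = eval p x y * eval q x y

-- The set of polynomials listed by a vector, possibly with repetitions.
⟨_⟩ : ∀ {n} → Vec Poly n → Pred Poly 0ℓ
⟨ ps ⟩ p = Any (p ≈_) ps

HasCardinality : Pred Poly 0ℓ → ℕ → Set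
HasCardinality S n =
  Σ[ e ∈ (Fin n → Poly) ] Injective _≡_ _≈_ e × (∀ p → S p ⇔ (∃[ j ] p ≈ e j))

SameUpToOrder : ∀ {m n} → Vec Poly m → Vec Poly n → Set
SameUpToOrder {m} {n} ps qs =
  Σ[ σ ∈ Permutation m n ] (∀ i → lookup ps i ≈ lookup qs (σ ⟨$⟩ʳ i))

-- Positive form of infinitude: no finite list exhausts S.
Infinite : {A : Set} → Pred A 0ℓ → Set
Infinite {A} S = (xs : List A) → ∃[ x ] S x × x ∉ xs

-- Colourings of the positive integers.
Colouring : ℕ → Set
Colouring r = (n : ℕ) → .{{NonZero n}} → Fin r

Monochromatic : ∀ {r k} → Colouring r → Pred (Vec ℚ k) 0ℓ
Monochromatic c t =
  ∃[ γ ] All (λ z → ∃[ n ] Σ[ n≢0 ∈ NonZero n ] z ≡ fromℕ n × c n {{n≢0}} ≡ γ) t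

PartitionRegular : ∀ {k} → Vec (ℕ → ℕ → ℚ) k → Set
PartitionRegular fs =
  ∀ r (c : Colouring r) →
  Infinite λ t → ∃[ u ] ∃[ v ] NonZero u × NonZero v ×
    t ≡ map (λ f → f u v) fs × Monochromatic c t

PolyPartitionRegular : ∀ {k} → Vec Poly k → Set
PolyPartitionRegular ps =
  PartitionRegular (map (λ p u v → eval p (fromℕ u) (fromℕ v)) ps)

productPattern : ∀ {k} → (q : Fin k → ℚ) (a b : Fin k → ℕ) (n m : Fin k → ℤ) →
                 Vec Poly (2 ℕ.+ k)
productPattern q a b n m =
  X ∷ Y ∷ tabulate λ i →
    con (q i) ⊗ (con (fromℕ (a i)) ⊗ X ⊕ con (fromℤ (n i)))
              ⊗ (con (fromℕ (b i)) ⊗ Y ⊕ con (fromℤ (m i)))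

scaledPattern : ℚ → Vec Poly 5
scaledPattern q =
  X ∷ Y ∷ con q ⊗ X ⊗ Y ∷ con q ⊗ X ⊗ Y ⊕ X ∷ con q ⊗ X ⊗ Y ⊕ Y ∷ []

unscaledPattern : Vec Poly 5
unscaledPattern = X ∷ Y ∷ X ⊗ Y ∷ X ⊗ Y ⊕ X ∷ X ⊗ Y ⊕ Y ∷ []

{-# OPTIONS --safe #-}

-- After clearing denominators the terms w satisfy N w = A x y + B x + C y + D
-- with A > 0 and A D = B C. Colouring by the approximate logarithm shows that
-- all A agree. Colouring by residues modulo a large prime p makes x, y and all w
-- congruent to a root z of A z² + (B + C − N) z + D. Hence equal sums B + C
-- force equal D, while two different sums determine z as a rational c / e.
-- In coordinates centred at z, colour by the last nonzero p-adic digit of n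
-- and by the position of its p-free part relative to the next power of p:
-- comparing valuations in the equations of two terms with different sums
-- gives z = 0 and (B, C, D) ∈ {(0, 0, 0), (N, 0, 0), (0, N, 0)}. So there are
-- at most three terms, and three terms are exactly q xy, q xy + x, q xy + y.
module Submission where

open import Data.Nat.Base as ℕ using (ℕ; zero; suc; NonZero; _≥_; _∸_) renaming (_+_ to _+ℕ_)
import Data.Nat.Properties as ℕ
import Data.Nat.DivMod as ℕ/
import Data.Nat.Tactic.RingSolver as ℕ
open import Data.Nat.Logarithm using (⌊log₂_⌋; ⌊log₂⌋-mono-≤; ⌊log₂[2*b]⌋≡1+⌊log₂b⌋)
import Data.Nat.Divisibility as ℕ∣
open import Data.Nat.ListAction using (product)
open import Data.Nat.Induction using (<-wellFounded)
open import Data.Nat.Primality as Primality using (Prime; prime⇒nonZero; euclidsLemma)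
open import Data.Nat.Primality.Factorisation using (factorise; PrimeFactorisation)
open import Data.Integer.Base as ℤ using (ℤ; +_; -[1+_]; _+_; _-_; _*_; -_; 0ℤ; 1ℤ) renaming (∣_∣ to abs)
import Data.Integer.Properties as ℤ
open import Data.Integer.Divisibility.Signed as ℤ∣ using (_∣_; divides)
open import Data.Integer.DivMod using (_%ℕ_; _/ℕ_; n%ℕd<d; a≡a%ℕn+[a/ℕn]*n)
open import Data.Integer.Tactic.RingSolver using (solve-∀)
open import Data.Rational.Base as ℚ using (ℚ; Positive; 0ℚ; 1ℚ; mkℚ)
import Data.Rational.Properties as ℚ
open import Algebra.Properties.CommutativeMonoid.Sum ℚ.+-0-commutativeMonoid using (sum; sum-cong-≗)
open import Data.Rational.Unnormalised.Base as ℚᵘ using (mkℚᵘ)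
import Data.Rational.Unnormalised.Properties as ℚᵘ
open import Data.Maybe.Base using (nothing)
open import Data.Vec.Base as Vec using (Vec; []; _∷_)
open import Data.Vec.Relation.Unary.All using ([]; _∷_)
import Data.Vec.Properties as Vec
import Data.Vec.Relation.Unary.All.Properties as Allᵛ
import Data.Vec.Relation.Unary.Any as Anyᵛ
import Data.Vec.Relation.Unary.Any.Properties as Anyᵛ
open import Data.Fin.Base as Fin using (Fin; zero; suc; toℕ; fromℕ<)
import Data.Fin.Properties as Fin
open import Data.Fin.Permutation using (Permutation; permutation; _⟨$⟩ʳ_)
open import Data.List.Base as List using (List; []; _∷_; _++_)
open import Data.List.Relation.Unary.All as All using (All; []; _∷_)
import Data.List.Relation.Unary.All.Properties as All
open import Data.List.Relation.Unary.Any using (here; there)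
open import Data.List.Membership.Propositional using (_∈_; _∉_)
open import Data.List.Membership.Propositional.Properties using (∈-map⁺; ∈-upTo⁺)
open import Data.Product.Base using (_×_; _,_; ∃-syntax; Σ-syntax; proj₁; proj₂)
open import Data.Sum.Base as Sum using (_⊎_; inj₁; inj₂)
open import Function.Bundles using (_⇔_; mk⇔; Equivalence)
open import Function.Definitions using (Injective)
open import Induction.WellFounded using (Acc; acc)
open import Relation.Nullary using (¬_; Dec; contradiction; yes; no)
open import Relation.Nullary.Decidable using (decidable-stable; ¬?)
open import Relation.Binary.Definitions using (Tri; tri<; tri≈; tri>)
open import Relation.Binary.PropositionalEquality
import Tactic.RingSolver as RingSolver
open import Tactic.RingSolver.Core.AlmostCommutativeRing using (AlmostCommutativeRing; fromCommutativeRing)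
open import Level using (0ℓ)
open import Defs

-- Why two different sums force z = 0: the numbers a, b, F share their last nonzero p-adic digit,
-- and which part of `A a b + β a + α b` dominates depends only on how the valuations of a and b
-- compare, so it is the same for every term. The relation A D = B C becomes αβ = A c ν; hence for c
-- ≠ 0 neither α nor β vanishes, and once one of them is known to be ν the other must be A c. In
-- this way α + β gets a value common to all terms, although by definition it is 2 A c + (B + C) e
-- and so varies with B + C. The obstacle is the case of equal valuations. There the last digits
-- leave two candidates for α + β, namely 0 and ν, and different terms could take different ones. If
-- α + β = ν, the linear parts cancel to leading order and only the quadratic term A a b could
-- betray this; digits modulo p do not see it. The position relative to the next power of p does,
-- and it excludes ν.

-- Divisibility, separating primes and residues

≡⇒∣ : ∀ {d x y} → x ≡ y → d ∣ y → d ∣ x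
≡⇒∣ refl d∣y = d∣y

≡-from-0 : ∀ {x y} → x - y ≡ 0ℤ → x ≡ y
≡-from-0 = ℤ.i-j≡0⇒i≡j _ _

-- Lets the ring solver work under hypotheses: each equation `l ≡ r` enters a polynomial identity as
-- a multiple of `l - r`, and nested calls remove these summands one at a time, the last one
-- innermost.
by-combination : ∀ {x y l r} t → x ≡ y + t * (l - r) → l ≡ r → x ≡ y
by-combination {x} {y} {l} {r} t eq refl = trans eq (lem y t l)
  where
  lem : ∀ y t l → y + t * (l - l) ≡ y
  lem = solve-∀

-- Euclid's argument: a prime factor of n! + 1 that is at most n would divide 1.
prime-exceeding : ∀ n → ∃[ p ] Prime p × n ℕ.< p
prime-exceeding n = go (factorise (suc (n ℕ.!)))
  where
  open PrimeFactorisation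

  divides-factorial : ∀ {p} → Prime p → p ℕ.≤ n → p ℕ∣.∣ n ℕ.!
  divides-factorial {zero}  pp _   = contradiction pp (λ ())
  divides-factorial {suc p} _  p≤n = ℕ∣.∣-trans (ℕ∣.m∣m*n (p ℕ.!)) (ℕ∣.m≤n⇒m!∣n! p≤n)

  go : PrimeFactorisation (suc (n ℕ.!)) → ∃[ p ] Prime p × n ℕ.< p
  go record { factors = [] ; isFactorisation = eq } =
    contradiction (ℕ.suc-injective eq) (ℕ.≢-nonZero⁻¹ _ {{n ℕ.!≢0}})
  go record { factors = p ∷ ps ; isFactorisation = eq ; factorsPrime = pp ∷ _ } =
    p , pp , ℕ.≰⇒> λ p≤n →
      contradiction pp (subst (λ m → ¬ Prime m) (sym (ℕ∣.∣1⇒≡1 (p∣1 p≤n))) Primality.¬prime[1])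
    where
    p∣1 : p ℕ.≤ n → p ℕ∣.∣ 1
    p∣1 p≤n = ℕ∣.∣m+n∣m⇒∣n
      (subst (p ℕ∣.∣_) (trans (sym eq) (ℕ.+-comm 1 (n ℕ.!))) (ℕ∣.m∣m*n (product ps)))
      (divides-factorial pp p≤n)

∣∧<⇒≡0 : ∀ {p} x → abs x ℕ.< p → + p ∣ x → x ≡ 0ℤ
∣∧<⇒≡0 x x<p p∣x = ℤ.∣i∣≡0⇒i≡0 (small x<p (ℤ∣.∣⇒∣ᵤ p∣x))
  where
  small : ∀ {m n} → m ℕ.< n → n ℕ∣.∣ m → m ≡ 0
  small {zero}  _   _   = refl
  small {suc m} m<n n∣m = contradiction n∣m (ℕ∣.>⇒∤ m<n)

-- A prime above the sum of the absolute values divides only those entries that are 0. This turns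
-- congruences between fixed numbers into equalities.
separating-prime : ∀ xs → ∃[ p ] Prime p × All (λ x → + p ∣ x → x ≡ 0ℤ) xs
separating-prime xs = let p , pp , lt = prime-exceeding (bound xs) in p , pp , small xs lt
  where
  bound : List ℤ → ℕ
  bound []       = 0
  bound (y ∷ ys) = abs y ℕ.+ bound ys
  small : ∀ {p} ys → bound ys ℕ.< p → All (λ x → + p ∣ x → x ≡ 0ℤ) ys
  small []       _  = []
  small (y ∷ ys) lt =
    ∣∧<⇒≡0 y (ℕ.≤-<-trans (ℕ.m≤m+n (abs y) _) lt) ∷
    small ys (ℕ.≤-<-trans (ℕ.m≤n+m (bound ys) (abs y)) lt)

euclid : ∀ {p} x y → Prime p → + p ∣ x * y → + p ∣ x ⊎ + p ∣ y
euclid {p} x y pp p∣xy =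
  Sum.map ℤ∣.∣ᵤ⇒∣ ℤ∣.∣ᵤ⇒∣
    (euclidsLemma (abs x) (abs y) pp (subst (p ℕ∣.∣_) (ℤ.abs-* x y) (ℤ∣.∣⇒∣ᵤ p∣xy)))

∤-* : ∀ {p x y} → Prime p → ¬ + p ∣ x → ¬ + p ∣ y → ¬ + p ∣ x * y
∤-* {x = x} {y} pp ¬x ¬y p∣xy = Sum.[ ¬x , ¬y ] (euclid x y pp p∣xy)

residue : ∀ p .{{_ : NonZero p}} → ℤ → Fin p
residue p x = fromℕ< (n%ℕd<d x p)

residue-≡⇒∣ : ∀ p .{{_ : NonZero p}} x y → residue p x ≡ residue p y → + p ∣ x - y
residue-≡⇒∣ p x y eq = divides (x /ℕ p - y /ℕ p) (trans
  (cong₂ _-_ (a≡a%ℕn+[a/ℕn]*n x p) (trans (a≡a%ℕn+[a/ℕn]*n y p) (cong (λ r → + r + (y /ℕ p) * + p) (sym rem))))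
  (lem (+ (x %ℕ p)) (x /ℕ p) (y /ℕ p) (+ p)))
  where
  rem : x %ℕ p ≡ y %ℕ p
  rem = trans (sym (Fin.toℕ-fromℕ< (n%ℕd<d x p))) (trans (cong toℕ eq) (Fin.toℕ-fromℕ< (n%ℕd<d y p)))
  lem : ∀ r q q′ d → r + q * d - (r + q′ * d) ≡ (q - q′) * d
  lem = solve-∀

-- p-adic valuations and digits

module Padic (p : ℕ) (pp : Prime p) where

  private instance
    p≢0 : NonZero p
    p≢0 = prime⇒nonZero pp

  π : ℕ → ℤ
  π s = + (p ℕ.^ s)

  π-suc : ∀ s → π (suc s) ≡ + p * π s
  π-suc s = ℤ.pos-* p (p ℕ.^ s)

  -- The number 0 receives valuation 0 and unit 0 by default, which keeps `val` and `unit` total;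
  -- for this reason `∤unit` is restricted to nonzero x.
  record Split (x : ℤ) : Set where
    field
      val    : ℕ
      unit   : ℤ
      factor : x ≡ π val * unit
      ∤unit  : x ≢ 0ℤ → ¬ + p ∣ unit

  abstract
   split : ∀ x → Split x
   split x = go x (<-wellFounded (abs x))
    where
    go : ∀ x → Acc ℕ._<_ (abs x) → Split x
    go x (acc rec) with x ℤ.≟ 0ℤ | + p ℤ∣.∣? x
    ... | yes refl | _ = record
      { val = 0 ; unit = 0ℤ ; factor = refl ; ∤unit = λ x≢0 → contradiction refl x≢0 }
    ... | no x≢0 | no p∤x = record
      { val = 0 ; unit = x ; factor = sym (ℤ.*-identityˡ x) ; ∤unit = λ _ → p∤x }
    ... | no x≢0 | yes (divides q refl) = record
      { val = suc (Split.val ih) ; unit = Split.unit ih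
      ; factor = trans (cong (_* + p) (Split.factor ih))
          (trans (lem (+ p) (π (Split.val ih)) (Split.unit ih))
                 (cong (_* Split.unit ih) (sym (π-suc (Split.val ih)))))
      ; ∤unit = λ _ → Split.∤unit ih q≢0 }
      where
      q≢0 : q ≢ 0ℤ
      q≢0 q≡0 = x≢0 (cong (_* + p) q≡0)
      smaller : abs q ℕ.< abs (q * + p)
      smaller = subst (abs q ℕ.<_) (sym (ℤ.abs-* q (+ p)))
        (ℕ.m<m*n (abs q) p {{ℕ.≢-nonZero λ e → q≢0 (ℤ.∣i∣≡0⇒i≡0 e)}}
          (ℕ.nonTrivial⇒n>1 p {{Primality.prime⇒nonTrivial pp}}))
      ih : Split q
      ih = go q (rec smaller)
      lem : ∀ d w m → w * m * d ≡ d * w * m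
      lem = solve-∀

  val : ℤ → ℕ
  val x = Split.val (split x)

  unit : ℤ → ℤ
  unit x = Split.unit (split x)

  unique : ∀ r s {x y} → ¬ + p ∣ x → ¬ + p ∣ y → π r * x ≡ π s * y → r ≡ s × x ≡ y
  unique zero    zero    _   _   eq = refl , trans (sym (ℤ.*-identityˡ _)) (trans eq (ℤ.*-identityˡ _))
  unique zero    (suc s) {x} {y} p∤x _ eq = contradiction
    (divides (π s * y) (trans (sym (ℤ.*-identityˡ x)) (trans eq (trans (cong (_* y) (π-suc s)) (lem (+ p) (π s) y))))) p∤x
    where
    lem : ∀ d w m → d * w * m ≡ w * m * d
    lem = solve-∀
  unique (suc r) zero    {x} {y} _ p∤y eq = contradiction
    (divides (π r * x) (trans (sym (ℤ.*-identityˡ y)) (trans (sym eq) (trans (cong (_* x) (π-suc r)) (lem (+ p) (π r) x))))) p∤y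
    where
    lem : ∀ d w m → d * w * m ≡ w * m * d
    lem = solve-∀
  unique (suc r) (suc s) {x} {y} p∤x p∤y eq =
    let r≡s , x≡y = unique r s p∤x p∤y (ℤ.*-cancelˡ-≡ (+ p) _ _
                      (trans (shift r x) (trans eq (sym (shift s y)))))
    in cong suc r≡s , x≡y
    where
    shift : ∀ r x → + p * (π r * x) ≡ π (suc r) * x
    shift r x = trans (sym (ℤ.*-assoc (+ p) (π r) x)) (cong (_* x) (sym (π-suc r)))

  -- Multiplication by ν, prime to p, keeps the valuation of F and multiplies its p-free part by ν,
  -- so uniqueness of the factorisation applies.
  same-unit : ∀ {ν F y} s → ¬ + p ∣ ν → F ≢ 0ℤ → ¬ + p ∣ y → ν * F ≡ π s * y →
              val F ≡ s × ν * unit F ≡ y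
  same-unit {ν} {F} {y} s p∤ν F≢0 p∤y eq =
    unique (val F) s (∤-* pp p∤ν (Split.∤unit (split F) F≢0)) p∤y
      (trans (sym (lem ν (π (val F)) (unit F))) (trans (cong (ν *_) (sym (Split.factor (split F)))) eq))
    where
    lem : ∀ n w m → n * (w * m) ≡ w * (n * m)
    lem = solve-∀

  -- The interval [jP/K, (j+1)P/K) containing the residue of m modulo P.
  module Bucket (K : ℕ) .{{_ : NonZero K}} where

    bucketMod : (P : ℕ) .{{_ : NonZero P}} → ℤ → Fin K
    bucketMod P m = fromℕ< (ℕ/.m<n*o⇒m/o<n (ℕ.*-monoʳ-< K (n%ℕd<d m P)))

    -- Equal quotients of K ρ and K ρ′ by P make K (ρ - ρ′) a difference of two remainders modulo P;
    -- the multiple `t` accounts for passing from m, m′ to their residues ρ, ρ′.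
    bucket-near : (P : ℕ) .{{_ : NonZero P}} → ∀ m m′ → bucketMod P m ≡ bucketMod P m′ →
                  ∃[ t ] abs (+ K * (m - m′ - t * + P)) ℕ.≤ P
    bucket-near P m m′ eq = m /ℕ P - m′ /ℕ P , subst (ℕ._≤ P) (cong abs (sym key)) small
      where
      ρ ρ′ : ℕ
      ρ  = m %ℕ P
      ρ′ = m′ %ℕ P
      r r′ : ℕ
      r  = (K ℕ.* ρ) ℕ.% P
      r′ = (K ℕ.* ρ′) ℕ.% P
      q : (K ℕ.* ρ) ℕ./ P ≡ (K ℕ.* ρ′) ℕ./ P
      q = trans (sym (Fin.toℕ-fromℕ< _)) (trans (cong toℕ eq) (Fin.toℕ-fromℕ< _))
      expand : ∀ ρ → + K * + ρ ≡ + ((K ℕ.* ρ) ℕ.% P) + + ((K ℕ.* ρ) ℕ./ P) * + P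
      expand ρ = trans (sym (ℤ.pos-* K ρ)) (trans (cong (λ z → + z) (ℕ/.m≡m%n+[m/n]*n (K ℕ.* ρ) P))
        (trans (ℤ.pos-+ ((K ℕ.* ρ) ℕ.% P) _) (cong (λ z → + ((K ℕ.* ρ) ℕ.% P) + z) (ℤ.pos-* ((K ℕ.* ρ) ℕ./ P) P))))
      lem₁ : ∀ k ρ ρ′ a b P → k * (ρ + a * P - (ρ′ + b * P) - (a - b) * P) ≡ k * ρ - k * ρ′
      lem₁ = solve-∀
      lem₂ : ∀ r r′ t P → r + t * P - (r′ + t * P) ≡ r - r′
      lem₂ = solve-∀
      key : + K * (m - m′ - (m /ℕ P - m′ /ℕ P) * + P) ≡ + r - + r′
      key = trans (cong₂ (λ x y → + K * (x - y - (m /ℕ P - m′ /ℕ P) * + P)) (a≡a%ℕn+[a/ℕn]*n m P) (a≡a%ℕn+[a/ℕn]*n m′ P))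
        (trans (lem₁ (+ K) (+ ρ) (+ ρ′) (m /ℕ P) (m′ /ℕ P) (+ P))
        (trans (cong₂ _-_ (expand ρ) (trans (expand ρ′) (cong (λ t → + r′ + + t * + P) (sym q))))
               (lem₂ (+ r) (+ r′) (+ ((K ℕ.* ρ) ℕ./ P)) (+ P))))
      small : abs (+ r - + r′) ℕ.≤ P
      small = subst (ℕ._≤ P) (cong abs (sym (ℤ.[+m]-[+n]≡m⊖n r r′)))
        (ℕ.≤-trans (ℤ.∣m⊝n∣≤m⊔n r r′)
          (ℕ.⊔-lub (ℕ.<⇒≤ (ℕ/.m%n<n (K ℕ.* ρ) P)) (ℕ.<⇒≤ (ℕ/.m%n<n (K ℕ.* ρ′) P))))

    -- The exponent s + 1 is the least for which p^s times a number prime to p is nonzero modulo the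
    -- power of p.
    bucket : ℕ → ℤ → Fin K
    bucket s = bucketMod (p ℕ.^ suc s) {{ℕ.m^n≢0 p (suc s)}}

    -- Modulo 1, the left side of eq divided by p^(s+1) is close to 0, while the
    -- term A p^s m m′ on the right gives a nonzero multiple of 1/p.
    bucket-contradiction : ∀ s {A ν α m m′ m″} →
      (abs ν ℕ.+ abs α) ℕ.* p ℕ.< K →
      ¬ + p ∣ A → ¬ + p ∣ m → ¬ + p ∣ m′ →
      bucket s m″ ≡ bucket s m →
      bucket s m′ ≡ bucket s m →
      ¬ (ν * (m″ - m) - α * (m′ - m) ≡ A * π s * m * m′)
    bucket-contradiction s {A} {ν} {α} {m} {m′} {m″} K-large p∤A p∤m p∤m′ b″ b′ eq =
      ℕ.<⇒≱ K-large (ℕ.*-cancelʳ-≤ K _ (p ℕ.^ s) {{ℕ.m^n≢0 p s}} (begin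
        K ℕ.* p ℕ.^ s                                       ≤⟨ ℕ.m≤m*n _ (abs g) {{g≢0}} ⟩
        K ℕ.* p ℕ.^ s ℕ.* abs g                             ≡⟨ cong (ℕ._* abs g) (ℤ.abs-* (+ K) (π s)) ⟨
        abs (+ K * π s) ℕ.* abs g                           ≡⟨ ℤ.abs-* (+ K * π s) g ⟨
        abs (+ K * π s * g)                                 ≡⟨ cong abs key ⟩
        abs (ν * x″ - α * x′)                               ≤⟨ ℤ.∣i-j∣≤∣i∣+∣j∣ (ν * x″) (α * x′) ⟩
        abs (ν * x″) ℕ.+ abs (α * x′)                       ≡⟨ cong₂ ℕ._+_ (ℤ.abs-* ν x″) (ℤ.abs-* α x′) ⟩
        abs ν ℕ.* abs x″ ℕ.+ abs α ℕ.* abs x′               ≤⟨ ℕ.+-mono-≤ (ℕ.*-monoʳ-≤ (abs ν) (proj₂ n″)) (ℕ.*-monoʳ-≤ (abs α) (proj₂ n′)) ⟩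
        abs ν ℕ.* p ℕ.^ suc s ℕ.+ abs α ℕ.* p ℕ.^ suc s     ≡⟨ ℕ.*-distribʳ-+ (p ℕ.^ suc s) (abs ν) (abs α) ⟨
        (abs ν ℕ.+ abs α) ℕ.* (p ℕ.* p ℕ.^ s)               ≡⟨ ℕ.*-assoc (abs ν ℕ.+ abs α) p _ ⟨
        (abs ν ℕ.+ abs α) ℕ.* p ℕ.* p ℕ.^ s                 ∎))
      where
      open ℕ.≤-Reasoning
      n″ : ∃[ t ] abs (+ K * (m″ - m - t * π (suc s))) ℕ.≤ p ℕ.^ suc s
      n″ = bucket-near (p ℕ.^ suc s) {{ℕ.m^n≢0 p (suc s)}} m″ m b″
      n′ : ∃[ t ] abs (+ K * (m′ - m - t * π (suc s))) ℕ.≤ p ℕ.^ suc s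
      n′ = bucket-near (p ℕ.^ suc s) {{ℕ.m^n≢0 p (suc s)}} m′ m b′
      t″ t′ x″ x′ g : ℤ
      t″ = proj₁ n″
      t′ = proj₁ n′
      x″ = + K * (m″ - m - t″ * π (suc s))
      x′ = + K * (m′ - m - t′ * π (suc s))
      g = A * m * m′ - (ν * t″ - α * t′) * + p
      g≢0 : NonZero (abs g)
      g≢0 = ℕ.≢-nonZero λ e → ∤-* pp (∤-* pp p∤A p∤m) p∤m′
        (divides (ν * t″ - α * t′) (≡-from-0 (ℤ.∣i∣≡0⇒i≡0 e)))
      key : + K * π s * g ≡ ν * x″ - α * x′
      key = by-combination (- + K)
        (trans (lem (+ K) (π s) A ν α m m′ m″ t″ t′ (+ p))
          (cong (λ P → ν * (+ K * (m″ - m - t″ * P)) - α * (+ K * (m′ - m - t′ * P))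
                       + - + K * (ν * (m″ - m) - α * (m′ - m) - A * π s * m * m′)) (sym (π-suc s))))
        eq
        where
        lem : ∀ K w A ν α m m′ m″ t″ t′ p → K * w * (A * m * m′ - (ν * t″ - α * t′) * p) ≡
          ν * (K * (m″ - m - t″ * (p * w))) - α * (K * (m′ - m - t′ * (p * w)))
          + - K * (ν * (m″ - m) - α * (m′ - m) - A * w * m * m′)
        lem = solve-∀

module Local (p : ℕ) (pp : Prime p) (K : ℕ) .{{K≢0 : NonZero K}} where
  open Padic p pp
  open Bucket K

  private instance
    p≢0 : NonZero p
    p≢0 = prime⇒nonZero pp

  abstract
    profile : ℤ → Fin (p ℕ.* K)
    profile x = Fin.combine (residue p (unit x)) (bucket (val x) (unit x))

    same-digit : ∀ {x y} → profile x ≡ profile y → + p ∣ unit x - unit y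
    same-digit {x} {y} eq = residue-≡⇒∣ p (unit x) (unit y)
      (Fin.combine-injectiveˡ (residue p (unit x)) (bucket (val x) (unit x))
                              (residue p (unit y)) (bucket (val y) (unit y)) eq)

    -- The modulus of a bucket depends on the valuation, so buckets of two numbers are comparable
    -- only when their valuations agree.
    same-bucket : ∀ {x y s} → profile x ≡ profile y → val x ≡ s → val y ≡ s →
                  bucket s (unit x) ≡ bucket s (unit y)
    same-bucket {x} {y} eq refl vy = trans
      (Fin.combine-injectiveʳ (residue p (unit x)) (bucket (val x) (unit x))
                              (residue p (unit y)) (bucket (val y) (unit y)) eq)
      (cong (λ s → bucket s (unit y)) vy)

  -- The common core of the valuation comparisons: the right side leads with the digit of β m and
  -- the left side with that of ν m, since F has the digit of m; cancelling m modulo p leaves ν and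
  -- β congruent.
  leading-digit : ∀ {ν β F m y} s → ¬ + p ∣ ν → ¬ + p ∣ β → ¬ + p ∣ m → F ≢ 0ℤ →
    + p ∣ y - β * m → + p ∣ unit F - m → ν * F ≡ π s * y →
    val F ≡ s × ν * unit F ≡ y × + p ∣ ν - β
  leading-digit {ν} {β} {F} {m} {y} s p∤ν p∤β p∤m F≢0 y≈βm F≈m eq =
    vF , νF , Sum.[ (λ z → z) , (λ p∣m → contradiction p∣m p∤m) ] (euclid (ν - β) m pp p∣)
    where
    p∤y : ¬ + p ∣ y
    p∤y p∣y = ∤-* pp p∤β p∤m (≡⇒∣ (lem y (β * m)) (ℤ∣.∣m∣n⇒∣m-n p∣y y≈βm))
      where
      lem : ∀ y z → z ≡ y - (y - z)
      lem = solve-∀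
    vF : val F ≡ s
    vF = proj₁ (same-unit s p∤ν F≢0 p∤y eq)
    νF : ν * unit F ≡ y
    νF = proj₂ (same-unit s p∤ν F≢0 p∤y eq)
    p∣ : + p ∣ (ν - β) * m
    p∣ = ≡⇒∣ (by-combination 1ℤ (lem ν β m (unit F) y) νF)
           (ℤ∣.∣m∣n⇒∣m-n y≈βm (ℤ∣.∣n⇒∣m*n ν F≈m))
      where
      lem : ∀ ν β m u y → (ν - β) * m ≡ y - β * m - ν * (u - m) + 1ℤ * (ν * u - y)
      lem = solve-∀

  private
    p∤unit : ∀ {x} → x ≢ 0ℤ → ¬ + p ∣ unit x
    p∤unit {x} = Split.∤unit (split x)
    factor : ∀ x → x ≡ π (val x) * unit x
    factor x = Split.factor (split x)
    p∣p* : ∀ x → + p ∣ + p * x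
    p∣p* x = ℤ∣.∣m⇒∣m*n x ℤ∣.∣-refl

  module _ (A α β : ℤ) {ν a b F : ℤ} (p∤ν : ¬ + p ∣ ν) (F≢0 : F ≢ 0ℤ) (a≢0 : a ≢ 0ℤ)
           (p∣b : + p ∣ b) (eq : ν * F ≡ A * a * b + β * a + α * b)
           (F∼a : profile F ≡ profile a) where

    -- Only β a has valuation `val a`: both A a b and α b are divisible by a higher power of p.
    val-smaller : val a ℕ.< val b → ¬ + p ∣ β → + p ∣ ν - β
    val-smaller lt p∤β = proj₂ (proj₂ (leading-digit s p∤ν p∤β (p∤unit a≢0) F≢0
        (≡⇒∣ (lem₁ (A * m * b) (β * m) (α * (+ p * (π k * m′)))) (ℤ∣.∣m∣n⇒∣m+n (ℤ∣.∣n⇒∣m*n (A * m) p∣b) (ℤ∣.∣n⇒∣m*n α (p∣p* _))))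
        (same-digit F∼a) main))
      where
      s = val a
      m = unit a
      m′ = unit b
      k = proj₁ (ℕ.m≤n⇒∃[o]m+o≡n lt)
      lem₁ : ∀ x y z → x + y + z - y ≡ x + z
      lem₁ = solve-∀
      πb : π (val b) ≡ π s * (+ p * π k)
      πb = trans (cong π (trans (sym (proj₂ (ℕ.m≤n⇒∃[o]m+o≡n lt))) (sym (ℕ.+-suc s k))))
             (trans (cong (λ z → + z) (ℕ.^-distribˡ-+-* p s (suc k)))
               (trans (ℤ.pos-* (p ℕ.^ s) (p ℕ.^ suc k)) (cong (π s *_) (π-suc k))))
      main : ν * F ≡ π s * (A * m * b + β * m + α * (+ p * (π k * m′)))
      main = trans eq (trans (cong₂ (λ x y → A * x * b + β * x + α * y) (factor a) (trans (factor b) (cong (_* m′) πb)))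
               (lem₂ A α β (π s) (+ p) (π k) m m′ b))
        where
        lem₂ : ∀ A α β w p v m m′ b →
          A * (w * m) * b + β * (w * m) + α * (w * (p * v) * m′) ≡ w * (A * m * b + β * m + α * (p * (v * m′)))
        lem₂ = solve-∀

    module _ (b∼a : profile b ≡ profile a) (val≡ : val b ≡ val a) (p∤α+β : ¬ + p ∣ α + β) where
      private
        s = val a
        m = unit a
        m′ = unit b
        -- As a and b share valuation and last digit, β a + α b leads with (α + β) m, while A a b is
        -- of higher order because p divides b.
        lemma : val F ≡ s × ν * unit F ≡ A * m * b + β * m + α * m′ × + p ∣ ν - (α + β)
        lemma = leading-digit s p∤ν p∤α+β (p∤unit a≢0) F≢0
          (≡⇒∣ (lem₁ (A * m * b) α β m m′) (ℤ∣.∣m∣n⇒∣m+n (ℤ∣.∣n⇒∣m*n (A * m) p∣b) (ℤ∣.∣n⇒∣m*n α (same-digit b∼a))))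
          (same-digit F∼a) main
          where
          lem₁ : ∀ x α β m m′ → x + β * m + α * m′ - (α + β) * m ≡ x + α * (m′ - m)
          lem₁ = solve-∀
          main : ν * F ≡ π s * (A * m * b + β * m + α * m′)
          main = trans eq (trans (cong₂ (λ x y → A * x * b + β * x + α * y) (factor a) (trans (factor b) (cong (λ t → π t * m′) val≡)))
                   (lem₂ A α β (π s) m m′ b))
            where
            lem₂ : ∀ A α β w m m′ b →
              A * (w * m) * b + β * (w * m) + α * (w * m′) ≡ w * (A * m * b + β * m + α * m′)
            lem₂ = solve-∀

      val-equal : + p ∣ ν - (α + β)
      val-equal = proj₂ (proj₂ lemma)

      -- If ν = α + β, subtracting ν m from the equation divided by p^s cancels the linear part, and
      -- what remains is exactly the relation refuted by `bucket-contradiction`.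
      val-equal-≢ : b ≢ 0ℤ → ¬ + p ∣ A → (abs ν ℕ.+ abs α) ℕ.* p ℕ.< K → ν ≢ α + β
      val-equal-≢ b≢0 p∤A K-large ν≡α+β =
        bucket-contradiction s {A} {ν} {α} {m} {m′} {unit F} K-large p∤A (p∤unit a≢0) (p∤unit b≢0)
          (same-bucket F∼a (proj₁ lemma) refl) (same-bucket b∼a val≡ refl)
          (∙0 (by-combination 1ℤ (trans (lem₁ ν A α β b m m′ (unit F)) (cong₂ (λ x y → x + y * m + 1ℤ * (ν * unit F - (A * m * b + β * m + α * m′)))
             (trans (cong (A * m *_) (trans (factor b) (cong (λ t → π t * m′) val≡))) (lem₂ A (π s) m m′))
             (trans (cong (λ z → α + β - z) ν≡α+β) (ℤ.+-inverseʳ (α + β)))) )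
             (proj₁ (proj₂ lemma))))
        where
        lem₁ : ∀ ν A α β b m m′ u → ν * (u - m) - α * (m′ - m) ≡
          A * m * b + (α + β - ν) * m + 1ℤ * (ν * u - (A * m * b + β * m + α * m′))
        lem₁ = solve-∀
        lem₂ : ∀ A w m m′ → A * m * (w * m′) ≡ A * w * m * m′
        lem₂ = solve-∀
        ∙0 : ∀ {x} → x ≡ A * π s * m * m′ + 0ℤ * m → x ≡ A * π s * m * m′
        ∙0 e = trans e (ℤ.+-identityʳ _)

  -- Serves the case where one of the two slopes vanishes and the right side factors: A a + α is
  -- congruent to α modulo p, so F is compared with b alone, whatever the valuation of a.
  factor-valuation : ∀ {ν A α a b F} → ¬ + p ∣ ν → ¬ + p ∣ α → F ≢ 0ℤ → b ≢ 0ℤ → + p ∣ a →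
    ν * F ≡ (A * a + α) * b → profile F ≡ profile b → + p ∣ ν - α
  factor-valuation {ν} {A} {α} {a} {b} p∤ν p∤α F≢0 b≢0 p∣a eq F∼b = proj₂ (proj₂ (leading-digit
      (val b) p∤ν p∤α (p∤unit b≢0) F≢0 (≡⇒∣ (lem₁ A a α (unit b)) (ℤ∣.∣n⇒∣m*n (A * unit b) p∣a)) (same-digit F∼b)
      (trans eq (trans (cong ((A * a + α) *_) (factor b)) (lem₂ (A * a + α) (π (val b)) (unit b))))))
    where
    lem₁ : ∀ A a α m → (A * a + α) * m - α * m ≡ A * m * a
    lem₁ = solve-∀
    lem₂ : ∀ x w m → x * (w * m) ≡ w * (x * m)
    lem₂ = solve-∀

-- Classification of the terms by congruences

record Hit {I : Set} (N : ℤ) (A B C D : I → ℤ) {r} (c : ℕ → Fin r) (M : ℕ) : Set where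
  field
    u v : ℕ
    w   : I → ℕ
    M<u : M ℕ.< u
    M<v : M ℕ.< v
    M<w : ∀ i → M ℕ.< w i
    v∼u : c v ≡ c u
    w∼u : ∀ i → c (w i) ≡ c u
    eq  : ∀ i → N * + w i ≡ A i * + u * + v + B i * + u + C i * + v + D i

-- The form in which partition regularity enters the classification: any colouring fitted to the
-- coefficients may be used, and the solutions may be taken beyond any bound M.
Recurrent : {I : Set} → ℤ → (A B C D : I → ℤ) → Set
Recurrent N A B C D = ∀ {r} (c : ℕ → Fin r) M → Hit N A B C D c M

*-≢0 : ∀ {x y} → x ≢ 0ℤ → y ≢ 0ℤ → x * y ≢ 0ℤ
*-≢0 {x} x≢0 y≢0 xy≡0 = Sum.[ x≢0 , y≢0 ] (ℤ.i*j≡0⇒i≡0∨j≡0 x xy≡0)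

*-cancelʳ : ∀ {z x y} → z ≢ 0ℤ → x * z ≡ y * z → x ≡ y
*-cancelʳ {z} {x} {y} z≢0 = ℤ.*-cancelʳ-≡ x y z {{ℤ.≢-nonZero z≢0}}

fixed-residue : ∀ {d} N A B C D u v w → N * w ≡ A * u * v + B * u + C * v + D →
  d ∣ v - u → d ∣ w - u → d ∣ A * u * u + (B + C - N) * u + D
fixed-residue {d} N A B C D u v w eq d∣v-u d∣w-u =
  ≡⇒∣ (by-combination (- 1ℤ) (lem N A B C D u v w) eq)
    (ℤ∣.∣m∣n⇒∣m-n (ℤ∣.∣n⇒∣m*n N d∣w-u) (ℤ∣.∣n⇒∣m*n (A * u + C) d∣v-u))
  where
  lem : ∀ N A B C D u v w → A * u * u + (B + C - N) * u + D ≡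
    N * (w - u) - (A * u + C) * (v - u) + - 1ℤ * (N * w - (A * u * v + B * u + C * v + D))
  lem = solve-∀

-- With equal sums the quadratic congruences for i and j differ only in their constant terms; a
-- modulus just above |D i - D j| then forces equality.
constant-term-determined : ∀ {I N A} {B C D : I → ℤ} → Recurrent N (λ _ → A) B C D →
  ∀ {i j} → B i + C i ≡ B j + C j → D i ≡ D j
constant-term-determined {I} {N} {A} {B} {C} {D} rec {i} {j} Ei≡Ej =
  ≡-from-0 (∣∧<⇒≡0 (D i - D j) ℕ.≤-refl p∣)
  where
  p : ℕ
  p = suc (abs (D i - D j))
  open Hit (rec {p} (λ n → residue p (+ n)) 0)
  fixed : ∀ l → + p ∣ A * + u * + u + (B l + C l - N) * + u + D l
  fixed l = fixed-residue N A (B l) (C l) (D l) (+ u) (+ v) (+ w l) (eq l)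
    (residue-≡⇒∣ p (+ v) (+ u) v∼u) (residue-≡⇒∣ p (+ w l) (+ u) (w∼u l))
  lem : ∀ x Ei Ej N u Di Dj → Di - Dj ≡ x + (Ei - N) * u + Di - (x + (Ej - N) * u + Dj) + - u * (Ei - Ej)
  lem = solve-∀
  p∣ : + p ∣ D i - D j
  p∣ = ≡⇒∣ (by-combination (- + u) (lem (A * + u * + u) (B i + C i) (B j + C j) N (+ u) (D i) (D j)) Ei≡Ej)
         (ℤ∣.∣m∣n⇒∣m-n (fixed i) (fixed j))

Shape : (N B C D : ℤ) → Set
Shape N B C D = D ≡ 0ℤ × (B ≡ 0ℤ × C ≡ 0ℤ ⊎ B ≡ N × C ≡ 0ℤ ⊎ B ≡ 0ℤ × C ≡ N)

-- The value of α + β in each order of the valuations of a and b. It mentions only data common to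
-- all terms, which is what makes two terms comparable.
sum-value : ∀ {x y z : Set} → ℤ → ℤ → Tri x y z → ℤ
sum-value ν Ac (tri< _ _ _) = ν + Ac
sum-value ν Ac (tri≈ _ _ _) = 0ℤ
sum-value ν Ac (tri> _ _ _) = ν + Ac

-- The value of u modulo a large prime is z = c / e. In the shifted coordinates
-- a = e u − c, b = e v − c, F = e w − c, which are all divisible by that prime,
-- the equation N w = A u v + B u + C v + D reads ν F = A a b + β a + α b.
module Shifted (N A e c B C D : ℤ) where
  ν α β R : ℤ
  ν = N * e
  β = A * c + B * e
  α = A * c + C * e
  R = A * c * c + (B + C - N) * c * e + D * e * e

  -- The numbers whose vanishing the case analysis must decide. The prime is chosen so that it
  -- divides one of them only if that number is 0.
  critical : List ℤ
  critical = R ∷ α ∷ β ∷ ν - α ∷ ν - β ∷ α + β ∷ ν - (α + β) ∷ []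

  R-divisible : ∀ {d} u → d ∣ A * u * u + (B + C - N) * u + D → d ∣ e * u - c → d ∣ R
  R-divisible {d} u d∣f d∣a = ≡⇒∣ (lem A c (B + C - N) D e u)
    (ℤ∣.∣m∣n⇒∣m-n (ℤ∣.∣n⇒∣m*n (e * e) d∣f) (ℤ∣.∣m⇒∣m*n (A * (c + e * u) + (B + C - N) * e) d∣a))
    where
    lem : ∀ A c E D e u → A * c * c + E * c * e + D * e * e ≡
      e * e * (A * u * u + E * u + D) - (e * u - c) * (A * (c + e * u) + E * e)
    lem = solve-∀

  shifted : ∀ u v w → R ≡ 0ℤ → N * w ≡ A * u * v + B * u + C * v + D →
    ν * (e * w - c) ≡ A * (e * u - c) * (e * v - c) + β * (e * u - c) + α * (e * v - c)
  shifted u v w R≡0 eq = by-combination 1ℤ (by-combination (e * e) (lem N A e c B C D u v w) eq) R≡0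
    where
    lem : ∀ N A e c B C D u v w → N * e * (e * w - c) ≡
      A * (e * u - c) * (e * v - c) + (A * c + B * e) * (e * u - c) + (A * c + C * e) * (e * v - c)
      + 1ℤ * (A * c * c + (B + C - N) * c * e + D * e * e - 0ℤ)
      + e * e * (N * w - (A * u * v + B * u + C * v + D))
    lem = solve-∀

  -- By A D = B C, multiplying A x y + B x + C y + D by A gives (A x + C)(A y + B). At the fixed
  -- point x = y = c / e, which `R ≡ 0ℤ` expresses, this product is A N c / e; the factor e² clears
  -- denominators.
  αβ : R ≡ 0ℤ → A * D ≡ B * C → α * β ≡ A * c * ν
  αβ R≡0 AD≡BC = by-combination A (by-combination (- (e * e)) (lem N A e c B C D) AD≡BC) R≡0
    where
    lem : ∀ N A e c B C D → (A * c + C * e) * (A * c + B * e) ≡ A * c * (N * e)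
      + A * (A * c * c + (B + C - N) * c * e + D * e * e - 0ℤ) + - (e * e) * (A * D - B * C)
    lem = solve-∀


  module Analysis (N≢0 : N ≢ 0ℤ) (A≢0 : A ≢ 0ℤ) (e≢0 : e ≢ 0ℤ) (AD≡BC : A * D ≡ B * C)
    {p : ℕ} (pp : Prime p) (K : ℕ) .{{K≢0 : NonZero K}} (K-large : (abs ν ℕ.+ abs α) ℕ.* p ℕ.< K)
    (p∤ν : ¬ + p ∣ ν) (p∤A : ¬ + p ∣ A) (separated : All (λ x → + p ∣ x → x ≡ 0ℤ) critical)
    where
    open Local p pp K
    open Padic p pp using (val)

    private
      crit : ∀ {x} → x ∈ critical → + p ∣ x → x ≡ 0ℤ
      crit = All.lookup separated
      indivisible : ∀ {x} → x ∈ critical → x ≢ 0ℤ → ¬ + p ∣ x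
      indivisible x∈ x≢0 p∣x = x≢0 (crit x∈ p∣x)
      ∈α : α ∈ critical
      ∈α = there (here refl)
      ∈β : β ∈ critical
      ∈β = there (there (here refl))
      ∈ν-α : ν - α ∈ critical
      ∈ν-α = there (there (there (here refl)))
      ∈ν-β : ν - β ∈ critical
      ∈ν-β = there (there (there (there (here refl))))
      ∈α+β : α + β ∈ critical
      ∈α+β = there (there (there (there (there (here refl)))))
      ∈ν-α-β : ν - (α + β) ∈ critical
      ∈ν-α-β = there (there (there (there (there (there (here refl))))))
      ν≢0 : ν ≢ 0ℤ
      ν≢0 = *-≢0 N≢0 e≢0

    module _ {a b F : ℤ} (a≢0 : a ≢ 0ℤ) (b≢0 : b ≢ 0ℤ) (F≢0 : F ≢ 0ℤ) (p∣a : + p ∣ a) (p∣b : + p ∣ b)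
      (b∼a : profile b ≡ profile a) (F∼a : profile F ≡ profile a)
      (p∣R : + p ∣ R) (eq : R ≡ 0ℤ → ν * F ≡ A * a * b + β * a + α * b) where

      private
        R≡0 : R ≡ 0ℤ
        R≡0 = crit (here refl) p∣R

        equation : ν * F ≡ A * a * b + β * a + α * b
        equation = eq R≡0

        swapped : ν * F ≡ A * b * a + α * b + β * a
        swapped = trans equation (lem A α β a b)
          where
          lem : ∀ A α β a b → A * a * b + β * a + α * b ≡ A * b * a + α * b + β * a
          lem = solve-∀

        F∼b : profile F ≡ profile b
        F∼b = trans F∼a (sym b∼a)

      -- Since αβ = A c ν is nonzero, α and β are prime to p and the valuation comparisons apply.
      -- Once one of them equals ν, cancelling ν leaves A c for the other.
      sum-determined : c ≢ 0ℤ → α + β ≡ sum-value ν (A * c) (ℕ.<-cmp (val a) (val b))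
      sum-determined c≢0 = by-cases (ℕ.<-cmp (val a) (val b))
        where
        product-≢0 : α * β ≢ 0ℤ
        product-≢0 αβ≡0 = *-≢0 (*-≢0 A≢0 c≢0) ν≢0 (trans (sym (αβ R≡0 AD≡BC)) αβ≡0)
        α≢0 : α ≢ 0ℤ
        α≢0 α≡0 = product-≢0 (cong (_* β) α≡0)
        β≢0 : β ≢ 0ℤ
        β≢0 β≡0 = product-≢0 (trans (cong (α *_) β≡0) (ℤ.*-zeroʳ α))

        by-cases : (t : Tri (val a ℕ.< val b) (val a ≡ val b) (val b ℕ.< val a)) →
                   α + β ≡ sum-value ν (A * c) t
        by-cases (tri< lt _ _) = trans (cong₂ _+_ α≡Ac (sym ν≡β)) (ℤ.+-comm (A * c) ν)
          where
          ν≡β : ν ≡ β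
          ν≡β = ≡-from-0 (crit ∈ν-β
            (val-smaller A α β p∤ν F≢0 a≢0 p∣b equation F∼a lt (indivisible ∈β β≢0)))
          α≡Ac : α ≡ A * c
          α≡Ac = *-cancelʳ ν≢0 (trans (cong (α *_) ν≡β) (αβ R≡0 AD≡BC))
        by-cases (tri> _ _ gt) = cong₂ _+_ (sym ν≡α) β≡Ac
          where
          ν≡α : ν ≡ α
          ν≡α = ≡-from-0 (crit ∈ν-α
            (val-smaller A β α p∤ν F≢0 b≢0 p∣a swapped F∼b gt (indivisible ∈α α≢0)))
          β≡Ac : β ≡ A * c
          β≡Ac = *-cancelʳ ν≢0 (trans (cong (β *_) ν≡α) (trans (ℤ.*-comm β α) (αβ R≡0 AD≡BC)))
        by-cases (tri≈ _ va≡vb _) = decidable-stable (α + β ℤ.≟ 0ℤ) λ α+β≢0 →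
          val-equal-≢ A α β p∤ν F≢0 a≢0 p∣b equation F∼a b∼a (sym va≡vb) (indivisible ∈α+β α+β≢0) b≢0 p∤A K-large
            (≡-from-0 (crit ∈ν-α-β
              (val-equal A α β p∤ν F≢0 a≢0 p∣b equation F∼a b∼a (sym va≡vb) (indivisible ∈α+β α+β≢0))))

      -- For the root 0 the constant term vanishes, hence B C = A D = 0 and one slope is 0. The
      -- equation then factors, and the other slope is 0 or matches ν.
      shape : c ≡ 0ℤ → Shape N B C D
      shape c≡0 = D≡0 , by-cases (ℤ.i*j≡0⇒i≡0∨j≡0 B BC≡0)
        where
        D≡0 : D ≡ 0ℤ
        D≡0 = *-cancelʳ {e * e} (*-≢0 e≢0 e≢0)
          (by-combination (- (A * c + (B + C - N) * e)) (by-combination 1ℤ (lem A c (B + C - N) D e) R≡0) c≡0)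
          where
          lem : ∀ A c E D e → D * (e * e) ≡ 0ℤ * (e * e) + - (A * c + E * e) * (c - 0ℤ)
            + 1ℤ * (A * c * c + E * c * e + D * e * e - 0ℤ)
          lem = solve-∀
        BC≡0 : B * C ≡ 0ℤ
        BC≡0 = trans (sym AD≡BC) (trans (cong (A *_) D≡0) (ℤ.*-zeroʳ A))

        slope : ∀ t → A * c + t * e ≡ t * e
        slope t = by-combination A (lem A c (t * e)) c≡0
          where
          lem : ∀ A c x → A * c + x ≡ x + A * (c - 0ℤ)
          lem = solve-∀
        collapse : ∀ t → A * c + t * e ≡ 0ℤ → t ≡ 0ℤ
        collapse t eq′ = *-cancelʳ e≢0 (trans (sym (slope t)) eq′)
        match : ∀ t → ν ≡ A * c + t * e → t ≡ N
        match t eq′ = sym (*-cancelʳ e≢0 (trans eq′ (slope t)))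
        vanish : ∀ t → t ≡ 0ℤ → A * c + t * e ≡ 0ℤ
        vanish t t≡0 = trans (slope t) (cong (_* e) t≡0)

        C-cases : B ≡ 0ℤ → C ≡ 0ℤ ⊎ C ≡ N
        C-cases B≡0 with α ℤ.≟ 0ℤ
        ... | yes α≡0 = inj₁ (collapse C α≡0)
        ... | no  α≢0 = inj₂ (match C (≡-from-0 (crit ∈ν-α
                (factor-valuation {A = A} p∤ν (indivisible ∈α α≢0) F≢0 b≢0 p∣a
                  (by-combination a (trans equation (lem A α β a b)) (vanish B B≡0)) F∼b))))
          where
          lem : ∀ A α β a b → A * a * b + β * a + α * b ≡ (A * a + α) * b + a * (β - 0ℤ)
          lem = solve-∀
        B-cases : C ≡ 0ℤ → B ≡ 0ℤ ⊎ B ≡ N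
        B-cases C≡0 with β ℤ.≟ 0ℤ
        ... | yes β≡0 = inj₁ (collapse B β≡0)
        ... | no  β≢0 = inj₂ (match B (≡-from-0 (crit ∈ν-β
                (factor-valuation {A = A} p∤ν (indivisible ∈β β≢0) F≢0 a≢0 p∣b
                  (by-combination b (trans equation (lem A α β a b)) (vanish C C≡0)) F∼a))))
          where
          lem : ∀ A α β a b → A * a * b + β * a + α * b ≡ (A * b + β) * a + b * (α - 0ℤ)
          lem = solve-∀

        by-cases : B ≡ 0ℤ ⊎ C ≡ 0ℤ → B ≡ 0ℤ × C ≡ 0ℤ ⊎ B ≡ N × C ≡ 0ℤ ⊎ B ≡ 0ℤ × C ≡ N
        by-cases (inj₁ B≡0) = Sum.map (B≡0 ,_) (λ C≡N → inj₂ (B≡0 , C≡N)) (C-cases B≡0)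
        by-cases (inj₂ C≡0) = Sum.map (_, C≡0) (λ B≡N → inj₁ (B≡N , C≡0)) (B-cases C≡0)

shifted-≢0 : ∀ {e} c w → e ≢ 0ℤ → abs c ℕ.< w → e * + w - c ≢ 0ℤ
shifted-≢0 {e} c w e≢0 c<w eq = ℕ.<⇒≱ c<w (begin
  w              ≤⟨ ℕ.m≤n*m w (abs e) {{ℕ.≢-nonZero λ z → e≢0 (ℤ.∣i∣≡0⇒i≡0 z)}} ⟩
  abs e ℕ.* w    ≡⟨ ℤ.abs-* e (+ w) ⟨
  abs (e * + w)  ≡⟨ cong abs (≡-from-0 {e * + w} {c} eq) ⟩
  abs c          ∎)
  where open ℕ.≤-Reasoning

module _ {I : Set} {N A : ℤ} {B C D : I → ℤ} (N≢0 : N ≢ 0ℤ) (A≢0 : A ≢ 0ℤ)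
         (AD≡BC : ∀ l → A * D l ≡ B l * C l) (rec : Recurrent N (λ _ → A) B C D)
         (i j : I) (Ei≢Ej : B i + C i ≢ B j + C j) where
  private
    e c : ℤ
    -- Subtracting the quadratic congruences of the terms i and j leaves e u congruent to c modulo
    -- p.
    e = B i + C i - (B j + C j)
    c = D j - D i
    e≢0 : e ≢ 0ℤ
    e≢0 e≡0 = Ei≢Ej (≡-from-0 e≡0)
    module S (l : I) = Shifted N A e c (B l) (C l) (D l)
    xs : List ℤ
    xs = N * e ∷ A ∷ S.critical i ++ S.critical j

    avoid : ∃[ p ] Prime p × All (λ x → + p ∣ x → x ≡ 0ℤ) xs
    avoid = separating-prime xs
    p : ℕ
    p = proj₁ avoid
    pp : Prime p
    pp = proj₁ (proj₂ avoid)
    separated : All (λ x → + p ∣ x → x ≡ 0ℤ) xs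
    separated = proj₂ (proj₂ avoid)
    sepᵢ : All (λ x → + p ∣ x → x ≡ 0ℤ) (S.critical i)
    sepᵢ = All.++⁻ˡ (S.critical i) (All.tail (All.tail separated))
    sepⱼ : All (λ x → + p ∣ x → x ≡ 0ℤ) (S.critical j)
    sepⱼ = All.++⁻ʳ (S.critical i) (All.tail (All.tail separated))
    p∤ν : ¬ + p ∣ N * e
    p∤ν p∣ν = *-≢0 N≢0 e≢0 (All.head separated p∣ν)
    p∤A : ¬ + p ∣ A
    p∤A p∣A = A≢0 (All.head (All.tail separated) p∣A)

    instance
      p≢0 : NonZero p
      p≢0 = prime⇒nonZero pp
    k K : ℕ
    -- Both α's are included so that one number of buckets is large enough for either term.
    k = (abs (N * e) ℕ.+ (abs (S.α i) ℕ.+ abs (S.α j))) ℕ.* p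
    K = suc k
    K-largeᵢ : (abs (N * e) ℕ.+ abs (S.α i)) ℕ.* p ℕ.< K
    K-largeᵢ = ℕ.s≤s (ℕ.*-monoˡ-≤ p (ℕ.+-monoʳ-≤ (abs (N * e)) (ℕ.m≤m+n (abs (S.α i)) (abs (S.α j)))))
    K-largeⱼ : (abs (N * e) ℕ.+ abs (S.α j)) ℕ.* p ℕ.< K
    K-largeⱼ = ℕ.s≤s (ℕ.*-monoˡ-≤ p (ℕ.+-monoʳ-≤ (abs (N * e)) (ℕ.m≤n+m (abs (S.α j)) (abs (S.α i)))))

    open Local p pp K
    open Padic p pp using (val)

    colour : ℕ → Fin (p ℕ.* (p ℕ.* K))
    colour n = Fin.combine (residue p (+ n)) (profile (e * + n - c))

    colour-residue : ∀ m n → colour m ≡ colour n → + p ∣ + m - + n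
    colour-residue m n eq = residue-≡⇒∣ p (+ m) (+ n)
      (Fin.combine-injectiveˡ (residue p (+ m)) (profile (e * + m - c)) (residue p (+ n)) (profile (e * + n - c)) eq)
    colour-profile : ∀ m n → colour m ≡ colour n → profile (e * + m - c) ≡ profile (e * + n - c)
    colour-profile m n =
      Fin.combine-injectiveʳ (residue p (+ m)) (profile (e * + m - c)) (residue p (+ n)) (profile (e * + n - c))

    -- Beyond |c| no number n satisfies e n = c, so all shifted coordinates are nonzero.
    open Hit (rec colour (abs c))

    fixed : ∀ l → + p ∣ A * + u * + u + (B l + C l - N) * + u + D l
    fixed l = fixed-residue N A (B l) (C l) (D l) (+ u) (+ v) (+ w l) (eq l)
                (colour-residue v u v∼u) (colour-residue (w l) u (w∼u l))

    p∣a : + p ∣ e * + u - c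
    p∣a = ≡⇒∣ (lem (A * + u * + u) (B i + C i) (B j + C j) N (+ u) (D i) (D j)) (ℤ∣.∣m∣n⇒∣m-n (fixed i) (fixed j))
      where
      lem : ∀ x Ei Ej N u Di Dj → (Ei - Ej) * u - (Dj - Di) ≡ x + (Ei - N) * u + Di - (x + (Ej - N) * u + Dj)
      lem = solve-∀
    p∣b : + p ∣ e * + v - c
    p∣b = ≡⇒∣ (lem e (+ u) (+ v) c) (ℤ∣.∣m∣n⇒∣m+n p∣a (ℤ∣.∣n⇒∣m*n e (colour-residue v u v∼u)))
      where
      lem : ∀ e u v c → e * v - c ≡ e * u - c + e * (v - u)
      lem = solve-∀

    a≢0 : e * + u - c ≢ 0ℤ
    a≢0 = shifted-≢0 c u e≢0 M<u
    b≢0 : e * + v - c ≢ 0ℤ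
    b≢0 = shifted-≢0 c v e≢0 M<v
    F≢0 : ∀ l → e * + w l - c ≢ 0ℤ
    F≢0 l = shifted-≢0 c (w l) e≢0 (M<w l)

    sums-equal : c ≢ 0ℤ → S.α i + S.β i ≡ S.α j + S.β j
    sums-equal c≢0 = trans
      (S.Analysis.sum-determined i N≢0 A≢0 e≢0 (AD≡BC i) pp K K-largeᵢ p∤ν p∤A sepᵢ a≢0 b≢0 (F≢0 i) p∣a p∣b
        (colour-profile v u v∼u) (colour-profile (w i) u (w∼u i)) (S.R-divisible i (+ u) (fixed i) p∣a)
        (λ R≡0 → S.shifted i (+ u) (+ v) (+ w i) R≡0 (eq i)) c≢0)
      (sym (S.Analysis.sum-determined j N≢0 A≢0 e≢0 (AD≡BC j) pp K K-largeⱼ p∤ν p∤A sepⱼ a≢0 b≢0 (F≢0 j) p∣a p∣b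
        (colour-profile v u v∼u) (colour-profile (w j) u (w∼u j)) (S.R-divisible j (+ u) (fixed j) p∣a)
        (λ R≡0 → S.shifted j (+ u) (+ v) (+ w j) R≡0 (eq j)) c≢0))

    -- As α + β = 2 A c + (B + C) e, the values for i and j differ by e²; their equality would force
    -- e = 0.
    c≡0 : c ≡ 0ℤ
    c≡0 = decidable-stable (c ℤ.≟ 0ℤ) λ c≢0 → *-≢0 e≢0 e≢0
      (by-combination 1ℤ (lem A (B i) (C i) (B j) (C j) c) (sums-equal c≢0))
      where
      lem : ∀ A Bi Ci Bj Cj c → (Bi + Ci - (Bj + Cj)) * (Bi + Ci - (Bj + Cj)) ≡
        0ℤ + 1ℤ * (A * c + Ci * (Bi + Ci - (Bj + Cj)) + (A * c + Bi * (Bi + Ci - (Bj + Cj)))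
                 - (A * c + Cj * (Bi + Ci - (Bj + Cj)) + (A * c + Bj * (Bi + Ci - (Bj + Cj)))))
      lem = solve-∀

  form-classified : Shape N (B i) (C i) (D i)
  form-classified = S.Analysis.shape i N≢0 A≢0 e≢0 (AD≡BC i) pp K K-largeᵢ p∤ν p∤A sepᵢ a≢0 b≢0 (F≢0 i) p∣a p∣b
    (colour-profile v u v∼u) (colour-profile (w i) u (w∼u i)) (S.R-divisible i (+ u) (fixed i) p∣a)
    (λ R≡0 → S.shifted i (+ u) (+ v) (+ w i) R≡0 (eq i)) c≡0

-- Leading coefficients

-- Writing u and v as 1 + b + c + d plus a remainder makes every coefficient of the difference
-- nonnegative; `excess` is that difference.
linear-≤-product : ∀ b c d {u v} → b ℕ.+ c ℕ.+ d ℕ.< u → b ℕ.+ c ℕ.+ d ℕ.< v →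
  ∃[ n ] u ℕ.* v ≡ b ℕ.* u ℕ.+ c ℕ.* v ℕ.+ d ℕ.+ n
linear-≤-product b c d M<u M<v =
  let x , eqx = ℕ.m≤n⇒∃[o]m+o≡n M<u
      y , eqy = ℕ.m≤n⇒∃[o]m+o≡n M<v
  in excess x y , trans (cong₂ ℕ._*_ (sym eqx) (sym eqy)) (trans (lem b c d x y)
       (cong₂ (λ u v → b ℕ.* u ℕ.+ c ℕ.* v ℕ.+ d ℕ.+ excess x y) eqx eqy))
  where
  excess : ℕ → ℕ → ℕ
  excess x y = d ℕ.* (1 ℕ.+ (b ℕ.+ c ℕ.+ d)) ℕ.+ b ℕ.+ c ℕ.+ 1
    ℕ.+ (c ℕ.+ d ℕ.+ 1) ℕ.* x ℕ.+ (b ℕ.+ d ℕ.+ 1) ℕ.* y ℕ.+ x ℕ.* y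
  lem : ∀ b c d x y → (1 ℕ.+ (b ℕ.+ c ℕ.+ d) ℕ.+ x) ℕ.* (1 ℕ.+ (b ℕ.+ c ℕ.+ d) ℕ.+ y) ≡
    b ℕ.* (1 ℕ.+ (b ℕ.+ c ℕ.+ d) ℕ.+ x) ℕ.+ c ℕ.* (1 ℕ.+ (b ℕ.+ c ℕ.+ d) ℕ.+ y) ℕ.+ d ℕ.+
    (d ℕ.* (1 ℕ.+ (b ℕ.+ c ℕ.+ d)) ℕ.+ b ℕ.+ c ℕ.+ 1
    ℕ.+ (c ℕ.+ d ℕ.+ 1) ℕ.* x ℕ.+ (b ℕ.+ d ℕ.+ 1) ℕ.* y ℕ.+ x ℕ.* y)
  lem = ℕ.solve-∀

+abs-natural : ∀ b → ∃[ n ] b + + abs b ≡ + n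
+abs-natural (+ n)    = n ℕ.+ n , refl
+abs-natural -[1+ n ] = 0 , ℤ.+-inverseˡ (+ suc n)

-- One copy of u v is spent on absorbing |b| u + |c| v + |d|; then b + |b|, c + |c| and d + |d| are
-- natural coefficients.
eventually-natural : ∀ a b c d → ∃[ M ] ∀ u v → M ℕ.< u → M ℕ.< v →
  ∃[ n ] + suc a * + u * + v + b * + u + c * + v + d ≡ + n
eventually-natural a b c d = abs b ℕ.+ abs c ℕ.+ abs d , λ u v M<u M<v →
  let n , eq = linear-≤-product (abs b) (abs c) (abs d) M<u M<v
      b′ , eqb = +abs-natural b
      c′ , eqc = +abs-natural c
      d′ , eqd = +abs-natural d
      eqℤ = trans (sym (ℤ.pos-* u v)) (trans (cong +_ eq) (casts (abs b) (abs c) (abs d) n u v))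
  in a ℕ.* u ℕ.* v ℕ.+ b′ ℕ.* u ℕ.+ c′ ℕ.* v ℕ.+ d′ ℕ.+ n ,
     by-combination 1ℤ (by-combination (+ u) (by-combination (+ v) (by-combination 1ℤ
       (trans (lem (+ a) b c d (+ abs b) (+ abs c) (+ abs d) (+ u) (+ v) (+ n) (+ b′) (+ c′) (+ d′))
         (cong (λ s → s + 1ℤ * (+ u * + v - (+ abs b * + u + + abs c * + v + + abs d + + n))
                        + + u * (b + + abs b - + b′) + + v * (c + + abs c - + c′) + 1ℤ * (d + + abs d - + d′))
           (sym (trans (casts′ (a ℕ.* u ℕ.* v) b′ c′ d′ n u v)
             (cong (λ s → s + + b′ * + u + + c′ * + v + + d′ + + n) (trans (ℤ.pos-* (a ℕ.* u) v) (cong (_* + v) (ℤ.pos-* a u))))))))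
       eqd) eqc) eqb) eqℤ
  where
  casts′ : ∀ e b c d n u v → + (e ℕ.+ b ℕ.* u ℕ.+ c ℕ.* v ℕ.+ d ℕ.+ n) ≡ + e + + b * + u + + c * + v + + d + + n
  casts′ e b c d n u v = cong₂ (λ x y → + e + x + y + + d + + n) (ℤ.pos-* b u) (ℤ.pos-* c v)
  casts : ∀ b c d n u v → + (b ℕ.* u ℕ.+ c ℕ.* v ℕ.+ d ℕ.+ n) ≡ + b * + u + + c * + v + + d + + n
  casts b c d n u v = cong₂ (λ x y → x + y + + d + + n) (ℤ.pos-* b u) (ℤ.pos-* c v)
  lem : ∀ a b c d βb βc βd u v n b′ c′ d′ → (1ℤ + a) * u * v + b * u + c * v + d ≡
    a * u * v + b′ * u + c′ * v + d′ + n
    + 1ℤ * (u * v - (βb * u + βc * v + βd + n)) + u * (b + βb - b′) + v * (c + βc - c′) + 1ℤ * (d + βd - d′)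
  lem = solve-∀

-- N (y wⱼ - x wᵢ) is again a bilinear form, with positive leading coefficient y Aⱼ - x Aᵢ, so it is
-- eventually nonnegative. This bounds ratios of terms by ratios of leading coefficients.
eventually-≤ : ∀ N .{{_ : NonZero N}} (Aᵢ Aⱼ : ℕ) (Bᵢ Bⱼ Cᵢ Cⱼ Dᵢ Dⱼ : ℤ) x y → x ℕ.* Aᵢ ℕ.< y ℕ.* Aⱼ →
  ∃[ M ] ∀ u v wᵢ wⱼ → M ℕ.< u → M ℕ.< v →
    + N * + wᵢ ≡ + Aᵢ * + u * + v + Bᵢ * + u + Cᵢ * + v + Dᵢ →
    + N * + wⱼ ≡ + Aⱼ * + u * + v + Bⱼ * + u + Cⱼ * + v + Dⱼ →
    x ℕ.* wᵢ ℕ.≤ y ℕ.* wⱼ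
eventually-≤ N Aᵢ Aⱼ Bᵢ Bⱼ Cᵢ Cⱼ Dᵢ Dⱼ x y lt =
  let a , eqa = ℕ.m≤n⇒∃[o]m+o≡n lt
      eqA = trans (sym (ℤ.pos-* y Aⱼ)) (trans (cong +_ (trans (sym eqa) (sym (ℕ.+-suc (x ℕ.* Aᵢ) a)))) (cong (_+ + suc a) (ℤ.pos-* x Aᵢ)))
      M , nat = eventually-natural a (+ y * Bⱼ - + x * Bᵢ) (+ y * Cⱼ - + x * Cᵢ) (+ y * Dⱼ - + x * Dᵢ)
  in M , λ u v wᵢ wⱼ M<u M<v eqᵢ eqⱼ →
  let n , eqn = nat u v M<u M<v
  in ℕ.*-cancelˡ-≤ N (ℕ.m+n≤o⇒m≤o (N ℕ.* (x ℕ.* wᵢ)) (ℕ.≤-reflexive (ℤ.+-injective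
      (trans (cong (_+ + n) (cast x wᵢ)) (trans
        (by-combination (- 1ℤ) (by-combination (- + y) (by-combination (+ x) (by-combination (- (+ u * + v))
          (lem (+ N) (+ x) (+ y) (+ Aᵢ) (+ Aⱼ) Bᵢ Bⱼ Cᵢ Cⱼ Dᵢ Dⱼ (+ u) (+ v) (+ wᵢ) (+ wⱼ) (+ n) (+ suc a))
          eqA) eqᵢ) eqⱼ) eqn)
        (sym (cast y wⱼ)))))))
  where
  cast : ∀ x w → + (N ℕ.* (x ℕ.* w)) ≡ + N * (+ x * + w)
  cast x w = trans (ℤ.pos-* N (x ℕ.* w)) (cong (+ N *_) (ℤ.pos-* x w))
  lem : ∀ N x y Ai Aj Bi Bj Ci Cj Di Dj u v wi wj n a → N * (x * wi) + n ≡ N * (y * wj)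
    + - 1ℤ * (a * u * v + (y * Bj - x * Bi) * u + (y * Cj - x * Ci) * v + (y * Dj - x * Di) - n)
    + - y * (N * wj - (Aj * u * v + Bj * u + Cj * v + Dj))
    + x * (N * wi - (Ai * u * v + Bi * u + Ci * v + Di))
    + - (u * v) * (y * Aj - (x * Ai + a))
  lem = solve-∀

-- Bernoulli's inequality (1 + 1/K)^n ≥ 1 + n/K, multiplied by K^(n+1).
bernoulli : ∀ K n → K ℕ.^ n ℕ.* (K ℕ.+ n) ℕ.≤ K ℕ.* suc K ℕ.^ n
bernoulli K zero    = ℕ.≤-reflexive (trans (ℕ.+-identityʳ (K ℕ.+ 0)) (trans (ℕ.+-identityʳ K) (sym (ℕ.*-identityʳ K))))
bernoulli K (suc n) = begin
  K ℕ.* K ℕ.^ n ℕ.* (K ℕ.+ suc n)          ≤⟨ ℕ.m≤m+n _ (K ℕ.^ n ℕ.* n) ⟩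
  K ℕ.* K ℕ.^ n ℕ.* (K ℕ.+ suc n) ℕ.+ K ℕ.^ n ℕ.* n ≡⟨ lem K n (K ℕ.^ n) ⟩
  suc K ℕ.* (K ℕ.^ n ℕ.* (K ℕ.+ n))        ≤⟨ ℕ.*-monoʳ-≤ (suc K) (bernoulli K n) ⟩
  suc K ℕ.* (K ℕ.* suc K ℕ.^ n)            ≡⟨ lem₂ K (suc K ℕ.^ n) ⟩
  K ℕ.* (suc K ℕ.* suc K ℕ.^ n)            ∎
  where
  open ℕ.≤-Reasoning
  lem : ∀ K n P → K ℕ.* P ℕ.* (K ℕ.+ (1 ℕ.+ n)) ℕ.+ P ℕ.* n ≡ (1 ℕ.+ K) ℕ.* (P ℕ.* (K ℕ.+ n))
  lem = ℕ.solve-∀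
  lem₂ : ∀ K P → (1 ℕ.+ K) ℕ.* (K ℕ.* P) ≡ K ℕ.* ((1 ℕ.+ K) ℕ.* P)
  lem₂ = ℕ.solve-∀

doubling : ∀ K .{{_ : NonZero K}} → 2 ℕ.* K ℕ.^ K ℕ.≤ suc K ℕ.^ K
doubling K = ℕ.*-cancelˡ-≤ K (ℕ.≤-trans (ℕ.≤-reflexive (lem K (K ℕ.^ K))) (bernoulli K K))
  where
  lem : ∀ K P → K ℕ.* (2 ℕ.* P) ≡ P ℕ.* (K ℕ.+ K)
  lem = ℕ.solve-∀

log-growth : ∀ t n .{{_ : NonZero n}} → ⌊log₂ 2 ℕ.^ t ℕ.* n ⌋ ≡ t ℕ.+ ⌊log₂ n ⌋
log-growth zero    n = cong ⌊log₂_⌋ (ℕ.+-identityʳ n)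
log-growth (suc t) n = trans (cong ⌊log₂_⌋ (ℕ.*-assoc 2 (2 ℕ.^ t) n))
  (trans (⌊log₂[2*b]⌋≡1+⌊log₂b⌋ (2 ℕ.^ t ℕ.* n) {{ℕ.m*n≢0 _ n {{ℕ.m^n≢0 2 t}}}}) (cong suc (log-growth t n)))

-- Since (1 + 1/K)^K ≥ 2, the number ⌊log₂ m^K⌋ grows by at least 1, and by
-- less than the modulus, from x to y.
log-colour-separates : ∀ K t .{{_ : NonZero K}} → let L = suc (t ℕ.* K) in
  ∀ x y .{{_ : NonZero x}} → suc K ℕ.* x ℕ.≤ K ℕ.* y → y ℕ.≤ 2 ℕ.^ t ℕ.* x →
  residue L (+ ⌊log₂ y ℕ.^ K ⌋) ≢ residue L (+ ⌊log₂ x ℕ.^ K ⌋)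
log-colour-separates K t x y lower upper eq = ℕ.<⇒≢ above (sym ℓ-equal)
  where
  ℓx ℓy : ℕ
  ℓx = ⌊log₂ x ℕ.^ K ⌋
  ℓy = ⌊log₂ y ℕ.^ K ⌋
  x^K≢0 : NonZero (x ℕ.^ K)
  x^K≢0 = ℕ.m^n≢0 x K
  ^-*-distrib : ∀ a b n → (a ℕ.* b) ℕ.^ n ≡ a ℕ.^ n ℕ.* b ℕ.^ n
  ^-*-distrib a b zero    = refl
  ^-*-distrib a b (suc n) = trans (cong (a ℕ.* b ℕ.*_) (^-*-distrib a b n)) (lem a b (a ℕ.^ n) (b ℕ.^ n))
    where
    lem : ∀ a b x y → a ℕ.* b ℕ.* (x ℕ.* y) ≡ a ℕ.* x ℕ.* (b ℕ.* y)
    lem = ℕ.solve-∀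
  double : 2 ℕ.* x ℕ.^ K ℕ.≤ y ℕ.^ K
  double = ℕ.*-cancelˡ-≤ (K ℕ.^ K) {{ℕ.m^n≢0 K K}} (begin
    K ℕ.^ K ℕ.* (2 ℕ.* x ℕ.^ K)   ≡⟨ lem (K ℕ.^ K) (x ℕ.^ K) ⟩
    2 ℕ.* K ℕ.^ K ℕ.* x ℕ.^ K     ≤⟨ ℕ.*-monoˡ-≤ (x ℕ.^ K) (doubling K) ⟩
    suc K ℕ.^ K ℕ.* x ℕ.^ K       ≡⟨ ^-*-distrib (suc K) x K ⟨
    (suc K ℕ.* x) ℕ.^ K           ≤⟨ ℕ.^-monoˡ-≤ K lower ⟩
    (K ℕ.* y) ℕ.^ K               ≡⟨ ^-*-distrib K y K ⟩
    K ℕ.^ K ℕ.* y ℕ.^ K           ∎)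
    where
    open ℕ.≤-Reasoning
    lem : ∀ a b → a ℕ.* (2 ℕ.* b) ≡ 2 ℕ.* a ℕ.* b
    lem = ℕ.solve-∀
  above : ℓx ℕ.< ℓy
  above = subst (ℕ._≤ ℓy) (⌊log₂[2*b]⌋≡1+⌊log₂b⌋ (x ℕ.^ K) {{x^K≢0}}) (⌊log₂⌋-mono-≤ double)
  below : ℓy ℕ.≤ t ℕ.* K ℕ.+ ℓx
  below = subst (ℓy ℕ.≤_) (log-growth (t ℕ.* K) (x ℕ.^ K) {{x^K≢0}})
    (⌊log₂⌋-mono-≤ (ℕ.≤-trans (ℕ.^-monoˡ-≤ K upper)
      (ℕ.≤-reflexive (trans (^-*-distrib (2 ℕ.^ t) x K) (cong (ℕ._* x ℕ.^ K) (ℕ.^-*-assoc 2 t K))))))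
  ℓ-equal : ℓy ≡ ℓx
  ℓ-equal = ℤ.+-injective (≡-from-0 (∣∧<⇒≡0 (+ ℓy - + ℓx)
    (ℕ.s≤s (subst (ℕ._≤ t ℕ.* K) (sym (cong abs (trans (ℤ.[+m]-[+n]≡m⊖n ℓy ℓx) (ℤ.⊖-≥ (ℕ.<⇒≤ above)))))
      (ℕ.m≤n+o⇒m∸n≤o ℓy ℓx (subst (ℓy ℕ.≤_) (ℕ.+-comm (t ℕ.* K) ℓx) below))))
    (residue-≡⇒∣ _ (+ ℓy) (+ ℓx) eq)))

n<2^n : ∀ n → n ℕ.< 2 ℕ.^ n
n<2^n zero    = ℕ.s≤s ℕ.z≤n
n<2^n (suc n) = ℕ.≤-trans (ℕ.+-mono-≤ (ℕ.m^n>0 2 n) (n<2^n n)) (ℕ.≤-reflexive (cong (2 ℕ.^ n ℕ.+_) (sym (ℕ.+-identityʳ _))))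

leading-coefficients-equal : ∀ {I : Set} {N} .{{_ : NonZero N}} {A : I → ℕ} {B C D : I → ℤ} →
  (∀ i → NonZero (A i)) → Recurrent (+ N) (λ i → + A i) B C D → ∀ i j → A i ≡ A j
leading-coefficients-equal {I} {N} {A} {B} {C} {D} A≢0 rec i j =
  ℕ.≤-antisym (ℕ.≮⇒≥ (not-smaller j i)) (ℕ.≮⇒≥ (not-smaller i j))
  where
  not-smaller : ∀ i j → ¬ A i ℕ.< A j
  not-smaller i j lt = log-colour-separates K t (w i) (w j) {{ℕ.>-nonZero (ℕ.≤-<-trans ℕ.z≤n (M<w i))}}
      (proj₂ lower u v (w i) (w j) (ℕ.m⊔n<o⇒m<o _ _ M<u) (ℕ.m⊔n<o⇒m<o _ _ M<v) (eq i) (eq j))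
      (subst (ℕ._≤ 2 ℕ.^ t ℕ.* w i) (ℕ.*-identityˡ (w j))
        (proj₂ upper u v (w j) (w i) (ℕ.m⊔n<o⇒n<o _ _ M<u) (ℕ.m⊔n<o⇒n<o _ _ M<v) (eq j) (eq i)))
      (trans (w∼u j) (sym (w∼u i)))
    where
    K t : ℕ
    -- Write a for `A i`. From (K + 1) a = a (a + 2) < (a + 1)² ≤ K `A j` the ratio of w j to w i is
    -- eventually at least 1 + 1/K; from t < 2^t, with t = `A j`, it is eventually at most 2^t.
    K = suc (A i)
    t = A j
    lower = eventually-≤ N (A i) (A j) (B i) (B j) (C i) (C j) (D i) (D j) (suc K) K
      (ℕ.<-≤-trans (ℕ.≤-reflexive (lem (A i))) (ℕ.*-monoʳ-≤ K lt))
      where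
      lem : ∀ a → 1 ℕ.+ (2 ℕ.+ a) ℕ.* a ≡ (1 ℕ.+ a) ℕ.* (1 ℕ.+ a)
      lem = ℕ.solve-∀
    upper = eventually-≤ N (A j) (A i) (B j) (B i) (C j) (C i) (D j) (D i) 1 (2 ℕ.^ t)
      (subst (ℕ._< 2 ℕ.^ t ℕ.* A i) (sym (ℕ.*-identityˡ t))
        (ℕ.<-≤-trans (n<2^n t) (ℕ.m≤m*n (2 ℕ.^ t) (A i) {{A≢0 i}})))
    open Hit (rec (λ n → residue (suc (t ℕ.* K)) (+ ⌊log₂ n ℕ.^ K ⌋)) (proj₁ lower ℕ.⊔ proj₁ upper))

-- Rescaling a pattern

ℚ-ring : AlmostCommutativeRing 0ℓ 0ℓ
ℚ-ring = fromCommutativeRing ℚ.+-*-commutativeRing (λ _ → nothing)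

module _ where
  open import Relation.Binary.Reasoning.Setoid ℚᵘ.≃-setoid

  fromℤ-+ : ∀ a b → fromℤ (a + b) ≡ fromℤ a ℚ.+ fromℤ b
  fromℤ-+ a b = ℚ.toℚᵘ-injective (begin
    ℚ.toℚᵘ (fromℤ (a + b))                  ≈⟨ ℚ.toℚᵘ-fromℚᵘ (mkℚᵘ (a + b) 0) ⟩
    mkℚᵘ (a + b) 0                          ≡⟨ cong (λ z → mkℚᵘ z 0) (cong₂ _+_ (ℤ.*-identityʳ a) (ℤ.*-identityʳ b)) ⟨
    mkℚᵘ a 0 ℚᵘ.+ mkℚᵘ b 0                  ≈⟨ ℚᵘ.+-cong (ℚ.toℚᵘ-fromℚᵘ (mkℚᵘ a 0)) (ℚ.toℚᵘ-fromℚᵘ (mkℚᵘ b 0)) ⟨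
    ℚ.toℚᵘ (fromℤ a) ℚᵘ.+ ℚ.toℚᵘ (fromℤ b)  ≈⟨ ℚ.toℚᵘ-homo-+ (fromℤ a) (fromℤ b) ⟨
    ℚ.toℚᵘ (fromℤ a ℚ.+ fromℤ b)            ∎)

  fromℤ-* : ∀ a b → fromℤ (a * b) ≡ fromℤ a ℚ.* fromℤ b
  fromℤ-* a b = ℚ.toℚᵘ-injective (begin
    ℚ.toℚᵘ (fromℤ (a * b))                  ≈⟨ ℚ.toℚᵘ-fromℚᵘ (mkℚᵘ (a * b) 0) ⟩
    mkℚᵘ a 0 ℚᵘ.* mkℚᵘ b 0                  ≈⟨ ℚᵘ.*-cong (ℚ.toℚᵘ-fromℚᵘ (mkℚᵘ a 0)) (ℚ.toℚᵘ-fromℚᵘ (mkℚᵘ b 0)) ⟨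
    ℚ.toℚᵘ (fromℤ a) ℚᵘ.* ℚ.toℚᵘ (fromℤ b)  ≈⟨ ℚ.toℚᵘ-homo-* (fromℤ a) (fromℤ b) ⟨
    ℚ.toℚᵘ (fromℤ a ℚ.* fromℤ b)            ∎)

fromℤ-injective : ∀ {a b} → fromℤ a ≡ fromℤ b → a ≡ b
fromℤ-injective {a} {b} eq =
  trans (sym (ℤ.*-identityʳ a)) (trans (ℚᵘ.drop-*≡* (ℚ./-injective-≃ (mkℚᵘ a 0) (mkℚᵘ b 0) eq)) (ℤ.*-identityʳ b))

fromℕ-injective : ∀ {m n} → fromℕ m ≡ fromℕ n → m ≡ n
fromℕ-injective eq = ℤ.+-injective (fromℤ-injective eq)

fromℕ-* : ∀ m n → fromℕ (m ℕ.* n) ≡ fromℕ m ℚ.* fromℕ n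
fromℕ-* m n = trans (cong fromℤ (ℤ.pos-* m n)) (fromℤ-* (+ m) (+ n))

numerator-denominator : ∀ q → Positive q →
  ∃[ m ] ∃[ n ] NonZero m × NonZero n × q ℚ.* fromℕ n ≡ fromℕ m
numerator-denominator q@(mkℚ (+ suc m) d _) _ = suc m , suc d , _ , _ , ℚ.toℚᵘ-injective (begin
    ℚ.toℚᵘ (q ℚ.* fromℕ (suc d))                ≈⟨ ℚ.toℚᵘ-homo-* q (fromℕ (suc d)) ⟩
    ℚ.toℚᵘ q ℚᵘ.* ℚ.toℚᵘ (fromℕ (suc d))        ≈⟨ ℚᵘ.*-cong (ℚᵘ.≃-refl {mkℚᵘ (+ suc m) d}) (ℚ.toℚᵘ-fromℚᵘ (mkℚᵘ (+ suc d) 0)) ⟩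
    mkℚᵘ (+ suc m) d ℚᵘ.* mkℚᵘ (+ suc d) 0      ≈⟨ ℚᵘ.*≡* (trans (ℤ.*-identityʳ _) (cong (λ z → + suc m * + suc z) (sym (ℕ.*-identityʳ d)))) ⟩
    mkℚᵘ (+ suc m) 0                            ≈⟨ ℚ.toℚᵘ-fromℚᵘ (mkℚᵘ (+ suc m) 0) ⟨
    ℚ.toℚᵘ (fromℕ (suc m))                      ∎)
  where open import Relation.Binary.Reasoning.Setoid ℚᵘ.≃-setoid

fromℕ-+ : ∀ m n → fromℕ (m ℕ.+ n) ≡ fromℕ m ℚ.+ fromℕ n
fromℕ-+ m n = trans (cong fromℤ (ℤ.pos-+ m n)) (fromℤ-+ (+ m) (+ n))

-- The colour of 0 is a default value; it makes the colouring applicable to arithmetic expressions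
-- that may vanish.
totalise : ∀ {r} → Colouring r → ℕ → Fin r
totalise c zero    = c 1
totalise c (suc n) = c (suc n)

totalise-≡ : ∀ {r} (c : Colouring r) n .{{_ : NonZero n}} → c n ≡ totalise c n
totalise-≡ c (suc n) = refl

point : ℚ → ℚ → ℚ → Vec ℚ 5
point q x y = x ∷ y ∷ q ℚ.* x ℚ.* y ∷ q ℚ.* x ℚ.* y ℚ.+ x ∷ q ℚ.* x ℚ.* y ℚ.+ y ∷ []

-- Colouring by residues modulo P makes all terms divisible by P, since x is
-- a difference of two terms; they can then be multiplied by ρ = Q / P.
module Rescale {q q′ ρ σ : ℚ} {P Q : ℕ} (P≢0 : NonZero P) (Q≢0 : NonZero Q)
               (ρP≡Q : ρ ℚ.* fromℕ P ≡ fromℕ Q) (q′ρ≡q : q′ ℚ.* ρ ≡ q) (σρ≡1 : σ ℚ.* ρ ≡ 1ℚ) where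
  private instance
    _ = P≢0
    _ = Q≢0

  scale-point : ∀ x y → Vec.map (ρ ℚ.*_) (point q x y) ≡ point q′ (ρ ℚ.* x) (ρ ℚ.* y)
  scale-point x y = cong₂ (λ a t → ρ ℚ.* x ∷ ρ ℚ.* y ∷ a ∷ t) (entry) (cong₂ (λ a b → a ∷ b ∷ [])
      (trans (ℚ.*-distribˡ-+ ρ (q ℚ.* x ℚ.* y) x) (cong (ℚ._+ ρ ℚ.* x) entry))
      (trans (ℚ.*-distribˡ-+ ρ (q ℚ.* x ℚ.* y) y) (cong (ℚ._+ ρ ℚ.* y) entry)))
    where
    lem : ∀ q ρ x y → ρ ℚ.* (q ℚ.* ρ ℚ.* x ℚ.* y) ≡ q ℚ.* (ρ ℚ.* x) ℚ.* (ρ ℚ.* y)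
    lem = RingSolver.solve-∀ ℚ-ring
    entry : ρ ℚ.* (q ℚ.* x ℚ.* y) ≡ q′ ℚ.* (ρ ℚ.* x) ℚ.* (ρ ℚ.* y)
    entry = trans (cong (λ s → ρ ℚ.* (s ℚ.* x ℚ.* y)) (sym q′ρ≡q)) (lem q′ ρ x y)

  unscale : ∀ {n} (t : Vec ℚ n) → Vec.map (σ ℚ.*_) (Vec.map (ρ ℚ.*_) t) ≡ t
  unscale []      = refl
  unscale (z ∷ t) = cong₂ _∷_
    (trans (sym (ℚ.*-assoc σ ρ z)) (trans (cong (ℚ._* z) σρ≡1) (ℚ.*-identityˡ z))) (unscale t)

  -- This is ρ n on multiples of P, where it matters. Elsewhere the quotient is rounded down and may
  -- be 0, so colourings are totalised before being composed with it.
  scaled : ℕ → ℕ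
  scaled n = Q ℕ.* (n ℕ./ P)

  scaled-≢0 : ∀ {n} → NonZero n → + P ∣ + n → NonZero (scaled n)
  scaled-≢0 {n} n≢0 P∣n with ℤ∣.∣⇒∣ᵤ P∣n
  ... | ℕ∣.divides k refl = ℕ.m*n≢0 Q (k ℕ.* P ℕ./ P) {{Q≢0}} {{subst NonZero (sym (ℕ/.m*n/n≡m k P)) (ℕ.m*n≢0⇒m≢0 k {{n≢0}})}}

  fromℕ-scaled : ∀ {n} → + P ∣ + n → ρ ℚ.* fromℕ n ≡ fromℕ (scaled n)
  fromℕ-scaled {n} P∣n with ℤ∣.∣⇒∣ᵤ P∣n
  ... | ℕ∣.divides k refl = begin
    ρ ℚ.* fromℕ (k ℕ.* P)             ≡⟨ cong (ρ ℚ.*_) (fromℕ-* k P) ⟩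
    ρ ℚ.* (fromℕ k ℚ.* fromℕ P)       ≡⟨ lem ρ (fromℕ k) (fromℕ P) ⟩
    ρ ℚ.* fromℕ P ℚ.* fromℕ k         ≡⟨ cong (ℚ._* fromℕ k) ρP≡Q ⟩
    fromℕ Q ℚ.* fromℕ k               ≡⟨ fromℕ-* Q k ⟨
    fromℕ (Q ℕ.* k)                   ≡⟨ cong (λ m → fromℕ (Q ℕ.* m)) (ℕ/.m*n/n≡m k P) ⟨
    fromℕ (scaled (k ℕ.* P))          ∎
    where
    open ≡-Reasoning
    lem : ∀ ρ k P → ρ ℚ.* (k ℚ.* P) ≡ ρ ℚ.* P ℚ.* k
    lem = RingSolver.solve-∀ ℚ-ring

  module _ {r} (c : Colouring r) where
    private
      colour : ℕ → Fin (P ℕ.* r)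
      colour n = Fin.combine (residue P (+ n)) (totalise c (scaled n))

      Coloured : Fin (P ℕ.* r) → ℚ → Set
      Coloured γ z = ∃[ n ] Σ[ n≢0 ∈ NonZero n ] z ≡ fromℕ n × colour n ≡ γ

      congruent : ∀ {γ} m n → colour m ≡ γ → colour n ≡ γ → + P ∣ + m - + n
      congruent m n cm cn = residue-≡⇒∣ P (+ m) (+ n) (Fin.combine-injectiveˡ
        (residue P (+ m)) (totalise c (scaled m)) (residue P (+ n)) (totalise c (scaled n)) (trans cm (sym cn)))

      rescale : ∀ {γ} ((u , _) : ∃[ u ] colour u ≡ γ) → + P ∣ + u → ∀ {z} → Coloured γ z →
        ∃[ n ] Σ[ n≢0 ∈ NonZero n ] ρ ℚ.* z ≡ fromℕ n × c n {{n≢0}} ≡ totalise c (scaled u)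
      rescale (u , cu) P∣u (n , n≢0 , refl , cn) =
        scaled n , scaled-≢0 n≢0 P∣n , fromℕ-scaled P∣n ,
        trans (totalise-≡ c (scaled n) {{scaled-≢0 n≢0 P∣n}})
          (Fin.combine-injectiveʳ (residue P (+ n)) (totalise c (scaled n))
            (residue P (+ u)) (totalise c (scaled u)) (trans cn (sym cu)))
        where
        P∣n : + P ∣ + n
        P∣n = ℤ∣.∣m+n∣n⇒∣m (≡⇒∣ (lem (+ n) (+ u)) (ℤ∣.∣m∣n⇒∣m+n (congruent n u cn cu) (ℤ∣.∣n⇒∣m*n (+ 2) P∣u))) P∣u
          where
          lem : ∀ n u → n + u ≡ n - u + + 2 * u
          lem = solve-∀

    monochromatic-rescaled : ∀ x y → Monochromatic (λ n → colour n) (point q x y) →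
      ∃[ u ] ∃[ v ] NonZero u × NonZero v × ρ ℚ.* x ≡ fromℕ u × ρ ℚ.* y ≡ fromℕ v ×
        Monochromatic c (Vec.map (ρ ℚ.*_) (point q x y))
    monochromatic-rescaled x y (γ , cx@(u , _ , refl , cu) ∷ cy ∷ c₃@(m , _ , eq₃ , cm) ∷ c₄@(n , _ , eq₄ , cn) ∷ c₅ ∷ []) =
      let u′ , u′≢0 , equ , _ = go cx
          v′ , v′≢0 , eqv , _ = go cy
      in u′ , v′ , u′≢0 , v′≢0 , equ , eqv , _ , go cx ∷ go cy ∷ go c₃ ∷ go c₄ ∷ go c₅ ∷ []
      where
      n≡m+u : n ≡ m ℕ.+ u
      n≡m+u = fromℕ-injective (trans (sym eq₄) (trans (cong (ℚ._+ fromℕ u) eq₃) (sym (fromℕ-+ m u))))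
      P∣u : + P ∣ + u
      P∣u = ≡⇒∣ (trans (lem (+ m) (+ u)) (cong (λ k → k - + m) (sym (trans (cong +_ n≡m+u) (ℤ.pos-+ m u))))) (congruent n m cn cm)
        where
        lem : ∀ m u → u ≡ m + u - m
        lem = solve-∀
      go : ∀ {z} → Coloured γ z → ∃[ n ] Σ[ n≢0 ∈ NonZero n ] ρ ℚ.* z ≡ fromℕ n × c n {{n≢0}} ≡ totalise c (scaled u)
      go = rescale (u , cu) P∣u

  rescaled : PolyPartitionRegular (scaledPattern q) → PolyPartitionRegular (scaledPattern q′)
  rescaled pr r c xs =
    -- The excluded tuples are pulled back along σ, the inverse of ρ: if the rescaled tuple lay in
    -- `xs`, then t would lie in the pulled back list.
    let t , (u , v , _ , _ , t≡ , mono) , t∉ = pr (P ℕ.* r) (λ n → Fin.combine (residue P (+ n)) (totalise c (scaled n))) (List.map (Vec.map (σ ℚ.*_)) xs)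
        u′ , v′ , u′≢0 , v′≢0 , equ , eqv , mono′ = monochromatic-rescaled c (fromℕ u) (fromℕ v)
          (subst (Monochromatic _) t≡ mono)
    in Vec.map (ρ ℚ.*_) t ,
       (u′ , v′ , u′≢0 , v′≢0 ,
        trans (cong (Vec.map (ρ ℚ.*_)) t≡) (trans (scale-point (fromℕ u) (fromℕ v)) (cong₂ (point q′) equ eqv)) ,
        subst (λ t → Monochromatic c (Vec.map (ρ ℚ.*_) t)) (sym t≡) mono′) ,
       λ t∈ → t∉ (subst (_∈ _) (unscale t) (∈-map⁺ (Vec.map (σ ℚ.*_)) t∈))

transfer : ∀ q q′ → Positive q → Positive q′ →
  PolyPartitionRegular (scaledPattern q) → PolyPartitionRegular (scaledPattern q′)
transfer q q′ q>0 q′>0 =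
  -- The factor ρ = q / q′ is forced by ρ (q x y) = q′ (ρ x) (ρ y).
  let m , n , m≢0 , n≢0 , eq = numerator-denominator (q ℚ.* ℚ.1/ q′) ρ>0
  in Rescale.rescaled {q} {q′} {q ℚ.* ℚ.1/ q′} {q′ ℚ.* ℚ.1/ q} n≢0 m≢0 eq
       (trans (lem₁ q q′ (ℚ.1/ q′)) (trans (cong (q ℚ.*_) (ℚ.*-inverseʳ q′)) (ℚ.*-identityʳ q)))
       (trans (lem₂ q q′ (ℚ.1/ q) (ℚ.1/ q′)) (trans (cong₂ ℚ._*_ (ℚ.*-inverseʳ q) (ℚ.*-inverseʳ q′)) (ℚ.*-identityʳ 1ℚ)))
  where
  instance
    _ = q>0
    _ = q′>0
    _ = ℚ.pos⇒nonZero q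
    _ = ℚ.pos⇒nonZero q′
  ρ>0 : Positive (q ℚ.* ℚ.1/ q′)
  ρ>0 = ℚ.pos*pos⇒pos q (ℚ.1/ q′) {{ℚ.1/pos⇒pos q′}}
  lem₁ : ∀ q q′ i → q′ ℚ.* (q ℚ.* i) ≡ q ℚ.* (q′ ℚ.* i)
  lem₁ = RingSolver.solve-∀ ℚ-ring
  lem₂ : ∀ q q′ i i′ → q′ ℚ.* i ℚ.* (q ℚ.* i′) ≡ q ℚ.* i ℚ.* (q′ ℚ.* i′)
  lem₂ = RingSolver.solve-∀ ℚ-ring

unscaled⇔scaled-1 : PolyPartitionRegular (scaledPattern 1ℚ) ⇔ PolyPartitionRegular unscaledPattern
unscaled⇔scaled-1 = mk⇔ (convert λ u v → points u v) (convert λ u v → sym (points u v))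
  where
  points : ∀ u v → Vec.map (λ f → f u v) (Vec.map (λ p u v → eval p (fromℕ u) (fromℕ v)) (scaledPattern 1ℚ))
                 ≡ Vec.map (λ f → f u v) (Vec.map (λ p u v → eval p (fromℕ u) (fromℕ v)) unscaledPattern)
  points u v = cong (λ z → fromℕ u ∷ fromℕ v ∷ z ℚ.* fromℕ v ∷ z ℚ.* fromℕ v ℚ.+ fromℕ u ∷ z ℚ.* fromℕ v ℚ.+ fromℕ v ∷ [])
                    (ℚ.*-identityˡ (fromℕ u))
  convert : ∀ {k} {fs gs : Vec (ℕ → ℕ → ℚ) k} → (∀ u v → Vec.map (λ f → f u v) fs ≡ Vec.map (λ f → f u v) gs) →
            PartitionRegular fs → PartitionRegular gs
  convert eq pr r c xs =
    let t , (u , v , u≢0 , v≢0 , t≡ , mono) , t∉ = pr r c xs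
    in t , (u , v , u≢0 , v≢0 , trans t≡ (eq u v) , mono) , t∉

scaled⇔unscaled : ∀ q → Positive q → PolyPartitionRegular (scaledPattern q) ⇔ PolyPartitionRegular unscaledPattern
scaled⇔unscaled q q>0 = mk⇔
  (λ pr → Equivalence.to unscaled⇔scaled-1 (transfer q 1ℚ q>0 _ pr))
  (λ pr → transfer 1ℚ q _ q>0 (Equivalence.from unscaled⇔scaled-1 pr))

-- Coefficients of the polynomials

sum-zero : ∀ {n} (f : Fin n → ℚ) → (∀ i → f i ≡ 0ℚ) → sum f ≡ 0ℚ
sum-zero {zero}  f f≡0 = refl
sum-zero {suc n} f f≡0 = cong₂ ℚ._+_ (f≡0 zero) (sum-zero (λ i → f (suc i)) (λ i → f≡0 (suc i)))

sum-head : ∀ {n} (f : Fin (suc n) → ℚ) → (∀ i → f (suc i) ≡ 0ℚ) → sum f ≡ f zero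
sum-head f f≡0 = trans (cong (f zero ℚ.+_) (sum-zero (λ i → f (suc i)) f≡0)) (ℚ.+-identityʳ (f zero))

coeff-con⊗ : ∀ c p i j → coeff (con c ⊗ p) i j ≡ c ℚ.* coeff p i j
coeff-con⊗ c p i j = trans
  (sum-head (λ (s : Fin (suc i)) → sum {suc j} λ t → coeff (con c) (toℕ s) (toℕ t) ℚ.* coeff p (i ∸ toℕ s) (j ∸ toℕ t))
    (λ s → sum-zero {suc j} _ (λ t → ℚ.*-zeroˡ (coeff p (i ∸ suc (toℕ s)) (j ∸ toℕ t)))))
  (sum-head {j} (λ t → coeff (con c) 0 (toℕ t) ℚ.* coeff p i (j ∸ toℕ t))
    (λ t → ℚ.*-zeroˡ (coeff p i (j ∸ suc (toℕ t)))))

linear : ℚ → ℚ → ℕ → ℚ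
linear α β 0 = β
linear α β 1 = α
linear α β _ = 0ℚ

linearˣ linearʸ : ℚ → ℚ → ℕ → ℕ → ℚ
linearˣ α β s zero    = linear α β s
linearˣ α β s (suc t) = 0ℚ
linearʸ γ δ zero    t = linear γ δ t
linearʸ γ δ (suc s) t = 0ℚ

-- The coefficient function of α x y + β x + γ y + δ.
bilinear : (α β γ δ : ℚ) → ℕ → ℕ → ℚ
bilinear α β γ δ i j = linear (linear α β j) (linear γ δ j) i

scale-linear : ∀ c α β j → c ℚ.* linear α β j ≡ linear (c ℚ.* α) (c ℚ.* β) j
scale-linear c α β 0             = refl
scale-linear c α β 1             = refl
scale-linear c α β (suc (suc j)) = ℚ.*-zeroʳ c

-- As p is free of y and r is free of x, only the summand with s = i and t = 0 can contribute to the
-- convolution.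
coeff-⊗ : ∀ p r {α β γ δ} → (∀ s t → coeff p s t ≡ linearˣ α β s t) → (∀ s t → coeff r s t ≡ linearʸ γ δ s t) →
  ∀ i j → coeff (p ⊗ r) i j ≡ bilinear (α ℚ.* γ) (α ℚ.* δ) (β ℚ.* γ) (β ℚ.* δ) i j
coeff-⊗ p r {α} {β} {γ} {δ} p≡ r≡ i j = trans (sum-cong-≗ {suc i} inner) (outer i)
  where
  inner : (s : Fin (suc i)) →
    sum {suc j} (λ t → coeff p (toℕ s) (toℕ t) ℚ.* coeff r (i ∸ toℕ s) (j ∸ toℕ t)) ≡
    linear α β (toℕ s) ℚ.* linearʸ γ δ (i ∸ toℕ s) j
  inner s = trans
    (sum-cong-≗ {suc j} (λ t → cong₂ ℚ._*_ (p≡ (toℕ s) (toℕ t)) (r≡ (i ∸ toℕ s) (j ∸ toℕ t))))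
    (sum-head {j} (λ t → linearˣ α β (toℕ s) (toℕ t) ℚ.* linearʸ γ δ (i ∸ toℕ s) (j ∸ toℕ t))
      (λ t → ℚ.*-zeroˡ (linearʸ γ δ (i ∸ toℕ s) (j ∸ suc (toℕ t)))))
  outer : ∀ i → sum {suc i} (λ s → linear α β (toℕ s) ℚ.* linearʸ γ δ (i ∸ toℕ s) j) ≡
    bilinear (α ℚ.* γ) (α ℚ.* δ) (β ℚ.* γ) (β ℚ.* δ) i j
  outer zero = trans (ℚ.+-identityʳ _) (scale-linear β γ δ j)
  outer (suc i) = trans
    (cong₂ ℚ._+_ (ℚ.*-zeroʳ β)
      (sum-head {i} (λ s → linear α β (suc (toℕ s)) ℚ.* linearʸ γ δ (i ∸ toℕ s) j)
        (λ s → ℚ.*-zeroˡ (linearʸ γ δ (i ∸ suc (toℕ s)) j))))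
    (trans (ℚ.+-identityˡ (α ℚ.* linearʸ γ δ i j)) (second i))
    where
    second : ∀ i → α ℚ.* linearʸ γ δ i j ≡ bilinear (α ℚ.* γ) (α ℚ.* δ) (β ℚ.* γ) (β ℚ.* δ) (suc i) j
    second zero    = scale-linear α γ δ j
    second (suc i) = ℚ.*-zeroʳ α

coeff-affineˣ : ∀ q a n s t → coeff (con q ⊗ (con a ⊗ X ⊕ con n)) s t ≡ linearˣ (q ℚ.* a) (q ℚ.* n) s t
coeff-affineˣ q a n s t = trans (coeff-con⊗ q (con a ⊗ X ⊕ con n) s t)
  (trans (cong (λ z → q ℚ.* (z ℚ.+ coeff (con n) s t)) (coeff-con⊗ a X s t)) (cases s t))
  where
  vanishing : ∀ q a → q ℚ.* (a ℚ.* 0ℚ ℚ.+ 0ℚ) ≡ 0ℚ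
  vanishing q a = trans (cong (λ z → q ℚ.* (z ℚ.+ 0ℚ)) (ℚ.*-zeroʳ a)) (ℚ.*-zeroʳ q)
  cases : ∀ s t → q ℚ.* (a ℚ.* coeff X s t ℚ.+ coeff (con n) s t) ≡ linearˣ (q ℚ.* a) (q ℚ.* n) s t
  cases 0 0             = cong (q ℚ.*_) (trans (cong (ℚ._+ n) (ℚ.*-zeroʳ a)) (ℚ.+-identityˡ n))
  cases 0 (suc t)       = vanishing q a
  cases 1 0             = cong (q ℚ.*_) (trans (ℚ.+-identityʳ _) (ℚ.*-identityʳ a))
  cases 1 (suc t)       = vanishing q a
  cases (suc (suc s)) 0 = vanishing q a
  cases (suc (suc s)) (suc t) = vanishing q a

coeff-affineʸ : ∀ b m s t → coeff (con b ⊗ Y ⊕ con m) s t ≡ linearʸ b m s t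
coeff-affineʸ b m s t = trans (cong (ℚ._+ coeff (con m) s t) (coeff-con⊗ b Y s t)) (cases s t)
  where
  vanishing : b ℚ.* 0ℚ ℚ.+ 0ℚ ≡ 0ℚ
  vanishing = trans (ℚ.+-identityʳ (b ℚ.* 0ℚ)) (ℚ.*-zeroʳ b)
  cases : ∀ s t → b ℚ.* coeff Y s t ℚ.+ coeff (con m) s t ≡ linearʸ b m s t
  cases 0 0             = trans (cong (ℚ._+ m) (ℚ.*-zeroʳ b)) (ℚ.+-identityˡ m)
  cases 0 1             = trans (ℚ.+-identityʳ _) (ℚ.*-identityʳ b)
  cases 0 (suc (suc t)) = vanishing
  cases (suc s) 0       = vanishing
  cases (suc s) (suc t) = vanishing

coeff-product : ∀ q a n b m i j →
  coeff (con q ⊗ (con a ⊗ X ⊕ con n) ⊗ (con b ⊗ Y ⊕ con m)) i j ≡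
  bilinear (q ℚ.* a ℚ.* b) (q ℚ.* a ℚ.* m) (q ℚ.* n ℚ.* b) (q ℚ.* n ℚ.* m) i j
coeff-product q a n b m = coeff-⊗ (con q ⊗ (con a ⊗ X ⊕ con n)) (con b ⊗ Y ⊕ con m) (coeff-affineˣ q a n) (coeff-affineʸ b m)

coeff-xy : ∀ q i j → coeff (con q ⊗ X ⊗ Y) i j ≡ bilinear q 0ℚ 0ℚ 0ℚ i j
coeff-xy q i j = trans
  (coeff-⊗ (con q ⊗ X) Y {α = q} {β = 0ℚ} {γ = 1ℚ} {δ = 0ℚ} left right i j)
  (cong₂ (λ a b → bilinear a b 0ℚ 0ℚ i j) (ℚ.*-identityʳ q) (ℚ.*-zeroʳ q))
  where
  cases : ∀ s t → q ℚ.* coeff X s t ≡ linearˣ q 0ℚ s t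
  cases 0 0             = ℚ.*-zeroʳ q
  cases 0 (suc t)       = ℚ.*-zeroʳ q
  cases 1 0             = ℚ.*-identityʳ q
  cases 1 (suc t)       = ℚ.*-zeroʳ q
  cases (suc (suc s)) 0 = ℚ.*-zeroʳ q
  cases (suc (suc s)) (suc t) = ℚ.*-zeroʳ q
  left : ∀ s t → coeff (con q ⊗ X) s t ≡ linearˣ q 0ℚ s t
  left s t = trans (coeff-con⊗ q X s t) (cases s t)
  right : ∀ s t → coeff Y s t ≡ linearʸ 1ℚ 0ℚ s t
  right 0 0             = refl
  right 0 1             = refl
  right 0 (suc (suc t)) = refl
  right (suc s) 0       = refl
  right (suc s) (suc t) = refl

coeff-xy+x : ∀ q i j → coeff (con q ⊗ X ⊗ Y ⊕ X) i j ≡ bilinear q 1ℚ 0ℚ 0ℚ i j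
coeff-xy+x q i j = trans (cong (ℚ._+ coeff X i j) (coeff-xy q i j)) (cases i j)
  where
  cases : ∀ i j → bilinear q 0ℚ 0ℚ 0ℚ i j ℚ.+ coeff X i j ≡ bilinear q 1ℚ 0ℚ 0ℚ i j
  cases 0 0 = refl
  cases 0 1 = refl
  cases 0 (suc (suc j)) = refl
  cases 1 0 = refl
  cases 1 1 = ℚ.+-identityʳ q
  cases 1 (suc (suc j)) = refl
  cases (suc (suc i)) 0 = refl
  cases (suc (suc i)) (suc j) = refl

coeff-xy+y : ∀ q i j → coeff (con q ⊗ X ⊗ Y ⊕ Y) i j ≡ bilinear q 0ℚ 1ℚ 0ℚ i j
coeff-xy+y q i j = trans (cong (ℚ._+ coeff Y i j) (coeff-xy q i j)) (cases i j)
  where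
  cases : ∀ i j → bilinear q 0ℚ 0ℚ 0ℚ i j ℚ.+ coeff Y i j ≡ bilinear q 0ℚ 1ℚ 0ℚ i j
  cases 0 0 = refl
  cases 0 1 = refl
  cases 0 (suc (suc j)) = refl
  cases 1 0 = refl
  cases 1 1 = ℚ.+-identityʳ q
  cases 1 (suc (suc j)) = refl
  cases (suc (suc i)) 0 = refl
  cases (suc (suc i)) (suc j) = refl

-- Finite injections and the cardinality hypothesis

-- Pigeonhole: punching out a missed value would inject n + 1 elements into n.
injective⇒surjective : ∀ {n} {f : Fin n → Fin n} → Injective _≡_ _≡_ f → ∀ y → ∃[ x ] f x ≡ y
injective⇒surjective {suc n} {f} f-inj y = decidable-stable (Fin.any? λ x → f x Fin.≟ y) λ missed →
  let y≢f : ∀ x → y ≢ f x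
      y≢f x y≡fx = missed (x , sym y≡fx)
  in ℕ.1+n≰n (Fin.injective⇒≤ {f = λ x → Fin.punchOut (y≢f x)}
       λ {x} {x′} eq → f-inj (Fin.punchOut-injective (y≢f x) (y≢f x′) eq))

injective⇒permutation : ∀ {n} (f : Fin n → Fin n) → Injective _≡_ _≡_ f →
                        Σ[ σ ∈ Permutation n n ] (∀ i → σ ⟨$⟩ʳ i ≡ f i)
injective⇒permutation f f-inj = permutation f (λ y → proj₁ (surj y)) (λ y → proj₂ (surj y))
    (λ x → f-inj (proj₂ (surj (f x)))) , λ i → refl
  where
  surj = injective⇒surjective f-inj

-- Each of the n inequivalent representatives occurs in the list, at distinct positions. These
-- positions exhaust the list of length n, so equivalent entries come from the same representative.
cardinality⇒injective : ∀ {n} (ps : Vec Poly n) → HasCardinality ⟨ ps ⟩ n →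
                        ∀ i j → Vec.lookup ps i ≈ Vec.lookup ps j → i ≡ j
cardinality⇒injective {n} ps (e , e-inj , e-char) i j pᵢ≈pⱼ =
  let s , idx-s = injective⇒surjective idx-inj i
      t , idx-t = injective⇒surjective idx-inj j
      s≡t = e-inj λ x y → trans (e≈ s x y) (trans (cong (λ l → coeff (Vec.lookup ps l) x y) idx-s)
              (trans (pᵢ≈pⱼ x y) (trans (cong (λ l → coeff (Vec.lookup ps l) x y) (sym idx-t)) (sym (e≈ t x y)))))
  in trans (sym idx-s) (trans (cong idx s≡t) idx-t)
  where
  listed : ∀ t → ⟨ ps ⟩ (e t)
  listed t = Equivalence.from (e-char (e t)) (t , λ _ _ → refl)
  idx : Fin n → Fin n
  idx t = Anyᵛ.index (listed t)
  e≈ : ∀ t → e t ≈ Vec.lookup ps (idx t)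
  e≈ t = Anyᵛ.lookup-index (listed t)
  idx-inj : Injective _≡_ _≡_ idx
  idx-inj {s} {t} eq = e-inj λ x y →
    trans (e≈ s x y) (trans (cong (λ l → coeff (Vec.lookup ps l) x y) eq) (sym (e≈ t x y)))

-- The three admissible forms

-- The pairs (B, C), indexed in the order of the last three entries of `scaledPattern`.
slopes : ℤ → Fin 3 → ℤ × ℤ
slopes N zero             = 0ℤ , 0ℤ
slopes N (suc zero)       = N , 0ℤ
slopes N (suc (suc zero)) = 0ℤ , N

kind : ∀ {N B C D} → Shape N B C D → Fin 3
kind (_ , inj₁ _)        = zero
kind (_ , inj₂ (inj₁ _)) = suc zero
kind (_ , inj₂ (inj₂ _)) = suc (suc zero)

kind-slopes : ∀ {N B C D} (s : Shape N B C D) →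
              B ≡ proj₁ (slopes N (kind s)) × C ≡ proj₂ (slopes N (kind s)) × D ≡ 0ℤ
kind-slopes (D≡0 , inj₁ (B≡ , C≡))        = B≡ , C≡ , D≡0
kind-slopes (D≡0 , inj₂ (inj₁ (B≡ , C≡))) = B≡ , C≡ , D≡0
kind-slopes (D≡0 , inj₂ (inj₂ (B≡ , C≡))) = B≡ , C≡ , D≡0

module Classification {k : ℕ} (k≥3 : k ≥ 3) {N A : ℤ} (N≢0 : N ≢ 0ℤ) (A≢0 : A ≢ 0ℤ) {B C D : Fin k → ℤ}
  (AD≡BC : ∀ i → A * D i ≡ B i * C i) (rec : Recurrent N (λ _ → A) B C D)
  (distinct : ∀ i j → B i ≡ B j → C i ≡ C j → D i ≡ D j → i ≡ j) where

  -- If all B + C agree with B i + C i, then so do all B C = A D, hence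
  -- {B j, C j} = {B i, C i} for all j: there are at most two forms.
  other-sum : ∀ i → ∃[ j ] B i + C i ≢ B j + C j
  other-sum i = decidable-stable (Fin.any? λ j → ¬? (B i + C i ℤ.≟ B j + C j)) λ none →
    let E≡ : ∀ j → B i + C i ≡ B j + C j
        E≡ j = decidable-stable (B i + C i ℤ.≟ B j + C j) λ ≢ → none (j , ≢)
        D≡ : ∀ j → D i ≡ D j
        D≡ j = constant-term-determined {N = N} {A} {B} {C} {D} rec {i} {j} (E≡ j)
    in ℕ.<⇒≱ k≥3 (Fin.injective⇒≤ {f = side} λ {j} {l} eq → side-injective E≡ D≡ j l eq)
    where
    side-of : ∀ {P : Set} → Dec P → Fin 2
    side-of (yes _) = zero
    side-of (no _)  = suc zero

    same-side : ∀ {P Q : Set} (p? : Dec P) (q? : Dec Q) → side-of p? ≡ side-of q? → P × Q ⊎ ¬ P × ¬ Q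
    same-side (yes p) (yes q) _ = inj₁ (p , q)
    same-side (no ¬p) (no ¬q) _ = inj₂ (¬p , ¬q)

    side : Fin k → Fin 2
    side j = side-of (B j ℤ.≟ B i)

    same-B : (∀ j → B i + C i ≡ B j + C j) → (∀ j → D i ≡ D j) → ∀ j l → side j ≡ side l → B j ≡ B l
    same-B E≡ D≡ j l eq = Sum.[ (λ (p , q) → trans p (sym q)) , (λ (¬p , ¬q) → trans (is-Cᵢ j ¬p) (sym (is-Cᵢ l ¬q))) ]
        (same-side (B j ℤ.≟ B i) (B l ℤ.≟ B i) eq)
      where
      BC≡ : ∀ j → B i * C i ≡ B j * C j
      BC≡ j = trans (sym (AD≡BC i)) (trans (cong (A *_) (D≡ j)) (AD≡BC j))
      is-Cᵢ : ∀ j → B j ≢ B i → B j ≡ C i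
      is-Cᵢ j Bj≢Bi = Sum.[ (λ z → contradiction (≡-from-0 {B j} {B i} z) Bj≢Bi) , ≡-from-0 {B j} {C i} ]
        (ℤ.i*j≡0⇒i≡0∨j≡0 (B j - B i)
          (by-combination 1ℤ (by-combination (- B j) (lem (B i) (C i) (B j) (C j)) (E≡ j)) (BC≡ j)))
        where
        lem : ∀ b c b′ c′ → (b′ - b) * (b′ - c) ≡ 0ℤ + 1ℤ * (b * c - b′ * c′) + - b′ * (b + c - (b′ + c′))
        lem = solve-∀

    side-injective : (∀ j → B i + C i ≡ B j + C j) → (∀ j → D i ≡ D j) → ∀ j l → side j ≡ side l → j ≡ l
    side-injective E≡ D≡ j l eq = distinct j l Bj≡Bl
        (by-combination 1ℤ (by-combination (- 1ℤ) (lem (B j) (C j) (B l) (C l)) Bj≡Bl) (trans (sym (E≡ j)) (E≡ l)))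
        (trans (sym (D≡ j)) (D≡ l))
      where
      Bj≡Bl = same-B E≡ D≡ j l eq
      lem : ∀ b c b′ c′ → c ≡ c′ + 1ℤ * (b + c - (b′ + c′)) + - 1ℤ * (b - b′)
      lem = solve-∀

  abstract
   shape : ∀ i → Shape N (B i) (C i) (D i)
   shape i = form-classified {N = N} {A} {B} {C} {D} N≢0 A≢0 AD≡BC rec i (proj₁ (other-sum i)) (proj₂ (other-sum i))

  -- The kind determines B, C and D, so distinctness of the terms embeds `Fin k` into `Fin 3`.
  kind-injective : Injective _≡_ _≡_ (λ i → kind {N} {B i} {C i} {D i} (shape i))
  kind-injective {i} {j} eq =
    let Bi , Ci , Di = kind-slopes {N} {B i} {C i} {D i} (shape i)
        Bj , Cj , Dj = kind-slopes {N} {B j} {C j} {D j} (shape j)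
    in distinct i j (trans Bi (trans (cong (λ t → proj₁ (slopes N t)) eq) (sym Bj)))
                    (trans Ci (trans (cong (λ t → proj₂ (slopes N t)) eq) (sym Cj)))
                    (trans Di (sym Dj))

  k≡3 : k ≡ 3
  k≡3 = ℕ.≤-antisym (Fin.injective⇒≤ kind-injective) k≥3

-- From the polynomial pattern to integer forms and back

common-denominator : ∀ {k} (q : Fin k → ℚ) → (∀ i → Positive (q i)) →
  ∃[ N ] NonZero N × Σ[ Q ∈ (Fin k → ℕ) ] (∀ i → NonZero (Q i)) × (∀ i → q i ℚ.* fromℕ N ≡ fromℕ (Q i))
common-denominator {zero}  q q>0 = 1 , _ , (λ ()) , (λ ()) , (λ ())
common-denominator {suc k} q q>0 =
  let N , N≢0 , Q , Q≢0 , eq = common-denominator (λ i → q (suc i)) (λ i → q>0 (suc i))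
      m , d , m≢0 , d≢0 , eq₀ = numerator-denominator (q zero) (q>0 zero)
  in d ℕ.* N , ℕ.m*n≢0 d N {{d≢0}} {{N≢0}} ,
     (λ { zero → m ℕ.* N ; (suc i) → Q i ℕ.* d }) ,
     (λ { zero → ℕ.m*n≢0 m N {{m≢0}} {{N≢0}} ; (suc i) → ℕ.m*n≢0 (Q i) d {{Q≢0 i}} {{d≢0}} }) ,
     λ { zero → trans (cong (q zero ℚ.*_) (fromℕ-* d N)) (trans (sym (ℚ.*-assoc (q zero) (fromℕ d) (fromℕ N)))
                  (trans (cong (ℚ._* fromℕ N) eq₀) (sym (fromℕ-* m N))))
       ; (suc i) → trans (cong (q (suc i) ℚ.*_) (fromℕ-* d N)) (trans (lem (q (suc i)) (fromℕ d) (fromℕ N))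
                  (trans (cong (ℚ._* fromℕ d) (eq i)) (sym (fromℕ-* (Q i) d)))) }
  where
  lem : ∀ q d N → q ℚ.* (d ℚ.* N) ≡ q ℚ.* N ℚ.* d
  lem = RingSolver.solve-∀ ℚ-ring

-- Giving each n ≤ M a colour of its own pushes the monochromatic tuples beyond M.
eventually-monochromatic : ∀ {k} {fs : Vec (ℕ → ℕ → ℚ) k} →
  PartitionRegular ((λ u v → fromℕ u) ∷ (λ u v → fromℕ v) ∷ fs) →
  ∀ {r} (c : ℕ → Fin r) M → ∃[ u ] ∃[ v ] M ℕ.< u × M ℕ.< v × c v ≡ c u ×
    (∀ i → ∃[ w ] M ℕ.< w × c w ≡ c u × Vec.lookup fs i u v ≡ fromℕ w)
eventually-monochromatic {k} {fs} pr {r} c M = conclude (pr _ (λ n → colour n) small)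
  where
  abstract
    colour : ℕ → Fin (suc (suc M) ℕ.* r)
    colour n = Fin.combine (fromℕ< {n ℕ.⊓ suc M} (ℕ.s≤s (ℕ.m⊓n≤n n (suc M)))) (c n)

    same-c : ∀ {m n} → colour m ≡ colour n → c m ≡ c n
    same-c {m} {n} = Fin.combine-injectiveʳ (fromℕ< {m ℕ.⊓ suc M} _) (c m) (fromℕ< {n ℕ.⊓ suc M} _) (c n)

    same-cap : ∀ {m n} → colour m ≡ colour n → m ℕ.⊓ suc M ≡ n ℕ.⊓ suc M
    same-cap {m} {n} eq = Fin.fromℕ<-injective _ _ _ _
      (Fin.combine-injectiveˡ (fromℕ< {m ℕ.⊓ suc M} _) (c m) (fromℕ< {n ℕ.⊓ suc M} _) (c n) eq)

  tuple : ℕ → ℕ → Vec ℚ (suc (suc k))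
  tuple u v = fromℕ u ∷ fromℕ v ∷ Vec.map (λ f → f u v) fs

  -- If u ≤ M, then v shares the private colour of u and equals it; excluding the finitely many
  -- diagonal tuples therefore suffices.
  small : List (Vec ℚ (suc (suc k)))
  small = List.map (λ n → tuple n n) (List.upTo (suc M))

  large : ∀ {m n} → colour m ≡ colour n → M ℕ.< n → M ℕ.< m
  large {m} {n} eq M<n = ℕ.m⊓n≡n⇒n≤m (trans (same-cap {m} {n} eq) (ℕ.m≥n⇒m⊓n≡n M<n))

  small-equal : ∀ {m n} → colour m ≡ colour n → n ℕ.≤ M → m ≡ n
  small-equal {m} {n} eq n≤M = trans (sym (ℕ.m≤n⇒m⊓n≡m m≤M+1)) (trans (same-cap {m} {n} eq) (ℕ.m≤n⇒m⊓n≡m (ℕ.m≤n⇒m≤1+n n≤M)))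
    where
    m≤M+1 : m ℕ.≤ suc M
    m≤M+1 = ℕ.<⇒≤ (ℕ.≰⇒> λ M<m → ℕ.<⇒≱ (large {n} {m} (sym eq) M<m) n≤M)

  conclude : ∃[ t ] (∃[ u ] ∃[ v ] NonZero u × NonZero v × t ≡ tuple u v × Monochromatic (λ n → colour n) t) × t ∉ small →
    ∃[ u ] ∃[ v ] M ℕ.< u × M ℕ.< v × c v ≡ c u × (∀ i → ∃[ w ] M ℕ.< w × c w ≡ c u × Vec.lookup fs i u v ≡ fromℕ w)
  conclude (_ , (u , v , _ , _ , refl , γ , (u′ , _ , u≡ , cu′) ∷ (v′ , _ , v≡ , cv′) ∷ cs) , t∉) =
    u , v , M<u , large {v} {u} v∼u M<u , same-c {v} {u} v∼u , λ i → entry i (Allᵛ.lookup⁺ cs i)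
    where
    cu : colour u ≡ γ
    cu = trans (cong colour (fromℕ-injective u≡)) cu′
    v∼u : colour v ≡ colour u
    v∼u = trans (cong colour (fromℕ-injective v≡)) (trans cv′ (sym cu))
    M<u : M ℕ.< u
    M<u = ℕ.≰⇒> λ u≤M → t∉ (subst (_∈ small) (cong (tuple u) (sym (small-equal {v} {u} v∼u u≤M)))
      (∈-map⁺ (λ n → tuple n n) (∈-upTo⁺ (ℕ.s≤s u≤M))))
    entry : ∀ i → ∃[ w ] Σ[ w≢0 ∈ NonZero w ] Vec.lookup (Vec.map (λ f → f u v) fs) i ≡ fromℕ w × colour w ≡ γ →
            ∃[ w ] M ℕ.< w × c w ≡ c u × Vec.lookup fs i u v ≡ fromℕ w
    entry i (w , _ , eq , cw) = w , large {w} {u} w∼u M<u , same-c {w} {u} w∼u ,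
      trans (sym (Vec.lookup-map i (λ f → f u v) fs)) eq
      where
      w∼u : colour w ≡ colour u
      w∼u = trans cw (sym cu)

fromℕ-positive : ∀ n → NonZero n → Positive (fromℕ n)
fromℕ-positive n n≢0 = ℚ.normalize-pos n 1 {{_}} {{n≢0}}

module Pattern {k : ℕ} (q : Fin k → ℚ) (a b : Fin k → ℕ) (n m : Fin k → ℤ) (q>0 : ∀ i → Positive (q i))
  (a≢0 : ∀ i → NonZero (a i)) (b≢0 : ∀ i → NonZero (b i)) (k≥3 : k ≥ 3)
  (cardinality : HasCardinality ⟨ productPattern q a b n m ⟩ (2 +ℕ k))
  (pr : PolyPartitionRegular (productPattern q a b n m)) where

  abstract
    denominators : ∃[ N ] NonZero N × Σ[ Q ∈ (Fin k → ℕ) ] (∀ i → NonZero (Q i)) × (∀ i → q i ℚ.* fromℕ N ≡ fromℕ (Q i))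
    denominators = common-denominator q q>0

  N : ℕ
  N = proj₁ denominators
  N≢0 : NonZero N
  N≢0 = proj₁ (proj₂ denominators)
  Q : Fin k → ℕ
  Q = proj₁ (proj₂ (proj₂ denominators))
  Q≢0 : ∀ i → NonZero (Q i)
  Q≢0 = proj₁ (proj₂ (proj₂ (proj₂ denominators)))
  qN≡Q : ∀ i → q i ℚ.* fromℕ N ≡ fromℕ (Q i)
  qN≡Q = proj₂ (proj₂ (proj₂ (proj₂ denominators)))

  A : Fin k → ℕ
  A i = Q i ℕ.* a i ℕ.* b i
  B C D : Fin k → ℤ
  B i = + Q i * + a i * m i
  C i = + Q i * n i * + b i
  D i = + Q i * n i * m i

  A≢0 : ∀ i → NonZero (A i)
  A≢0 i = ℕ.m*n≢0 (Q i ℕ.* a i) (b i) {{ℕ.m*n≢0 (Q i) (a i) {{Q≢0 i}} {{a≢0 i}}}} {{b≢0 i}}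

  A-product : ∀ i → + A i ≡ + Q i * + a i * + b i
  A-product i = trans (ℤ.pos-* (Q i ℕ.* a i) (b i)) (cong (_* + b i) (ℤ.pos-* (Q i) (a i)))

  -- This relation carries the factorisation of a term into a factor in x and a factor in y over to
  -- its integer coefficients.
  AD≡BC : ∀ i → + A i * D i ≡ B i * C i
  AD≡BC i = trans (cong (_* D i) (A-product i)) (lem (+ Q i) (+ a i) (+ b i) (n i) (m i))
    where
    lem : ∀ Q a b n m → Q * a * b * (Q * n * m) ≡ Q * a * m * (Q * n * b)
    lem = solve-∀

  term : Fin k → Poly
  term i = con (q i) ⊗ (con (fromℕ (a i)) ⊗ X ⊕ con (fromℤ (n i))) ⊗ (con (fromℕ (b i)) ⊗ Y ⊕ con (fromℤ (m i)))

  fromℤ-affine : ∀ a x n → fromℤ (a * x + n) ≡ fromℤ a ℚ.* fromℤ x ℚ.+ fromℤ n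
  fromℤ-affine a x n = trans (fromℤ-+ (a * x) n) (cong (ℚ._+ fromℤ n) (fromℤ-* a x))

  integral-form : ∀ i u v w → eval (term i) (fromℕ u) (fromℕ v) ≡ fromℕ w →
    + N * + w ≡ + A i * + u * + v + B i * + u + C i * + v + D i
  integral-form i u v w eq = trans (fromℤ-injective (begin
      fromℤ (+ N * + w)                                          ≡⟨ fromℤ-* (+ N) (+ w) ⟩
      fromℕ N ℚ.* fromℕ w                                        ≡⟨ cong (fromℕ N ℚ.*_) eq ⟨
      fromℕ N ℚ.* (q i ℚ.* s ℚ.* t)                              ≡⟨ lem₁ (fromℕ N) (q i) s t ⟩
      q i ℚ.* fromℕ N ℚ.* s ℚ.* t                                ≡⟨ cong (λ z → z ℚ.* s ℚ.* t) (qN≡Q i) ⟩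
      fromℕ (Q i) ℚ.* s ℚ.* t                                    ≡⟨ cong₂ (λ y z → fromℕ (Q i) ℚ.* y ℚ.* z) (fromℤ-affine (+ a i) (+ u) (n i)) (fromℤ-affine (+ b i) (+ v) (m i)) ⟨
      fromℕ (Q i) ℚ.* fromℤ (+ a i * + u + n i) ℚ.* fromℤ (+ b i * + v + m i) ≡⟨ cong (ℚ._* fromℤ (+ b i * + v + m i)) (fromℤ-* (+ Q i) (+ a i * + u + n i)) ⟨
      fromℤ (+ Q i * (+ a i * + u + n i)) ℚ.* fromℤ (+ b i * + v + m i)       ≡⟨ fromℤ-* (+ Q i * (+ a i * + u + n i)) (+ b i * + v + m i) ⟨
      fromℤ (+ Q i * (+ a i * + u + n i) * (+ b i * + v + m i))               ∎))
    (trans (lem₂ (+ Q i) (+ a i) (+ b i) (n i) (m i) (+ u) (+ v))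
           (cong (λ z → z * + u * + v + B i * + u + C i * + v + D i) (sym (A-product i))))
    where
    open ≡-Reasoning
    s t : ℚ
    s = fromℕ (a i) ℚ.* fromℕ u ℚ.+ fromℤ (n i)
    t = fromℕ (b i) ℚ.* fromℕ v ℚ.+ fromℤ (m i)
    lem₁ : ∀ N q s t → N ℚ.* (q ℚ.* s ℚ.* t) ≡ q ℚ.* N ℚ.* s ℚ.* t
    lem₁ = RingSolver.solve-∀ ℚ-ring
    lem₂ : ∀ Q a b n m u v → Q * (a * u + n) * (b * v + m) ≡
      Q * a * b * u * v + Q * a * m * u + Q * n * b * v + Q * n * m
    lem₂ = solve-∀

  recurrent : Recurrent (+ N) (λ i → + A i) B C D
  recurrent c M =
    let u , v , M<u , M<v , v∼u , terms = eventually-monochromatic pr c M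
    in record
      { u = u ; v = v ; w = λ i → proj₁ (terms i) ; M<u = M<u ; M<v = M<v ; v∼u = v∼u
      ; M<w = λ i → proj₁ (proj₂ (terms i))
      ; w∼u = λ i → proj₁ (proj₂ (proj₂ (terms i)))
      ; eq  = λ i → integral-form i u v (proj₁ (terms i))
          (trans (sym (value i u v)) (proj₂ (proj₂ (proj₂ (terms i)))))
      }
    where
    value : ∀ i u v → Vec.lookup (Vec.map (λ p u v → eval p (fromℕ u) (fromℕ v)) (Vec.tabulate term)) i u v ≡
                      eval (term i) (fromℕ u) (fromℕ v)
    value i u v = trans
      (cong (λ f → f u v) (Vec.lookup-map i (λ p u v → eval p (fromℕ u) (fromℕ v)) (Vec.tabulate term)))
      (cong (λ p → eval p (fromℕ u) (fromℕ v)) (Vec.lookup∘tabulate term i))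

  -- A reference index, whose leading coefficient stands for the common one.
  i₀ : Fin k
  i₀ = Fin.inject≤ zero k≥3

  A≡ : ∀ i → A i ≡ A i₀
  A≡ i = leading-coefficients-equal {{N≢0}} A≢0 recurrent i i₀

  private instance
    _ = N≢0
    fromℕ-N>0 : Positive (fromℕ N)
    fromℕ-N>0 = fromℕ-positive N N≢0
    fromℕ-N≢0 : ℚ.NonZero (fromℕ N)
    fromℕ-N≢0 = ℚ.pos⇒nonZero (fromℕ N)

  κ : ℚ
  κ = ℚ.1/ fromℕ N

  κN≡1 : κ ℚ.* fromℕ N ≡ 1ℚ
  κN≡1 = ℚ.*-inverseˡ (fromℕ N)

  q≡κQ : ∀ i → q i ≡ κ ℚ.* fromℕ (Q i)
  q≡κQ i = trans (sym (trans (cong (q i ℚ.*_) κN≡1) (ℚ.*-identityʳ (q i))))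
    (trans (lem (q i) κ (fromℕ N)) (cong (κ ℚ.*_) (qN≡Q i)))
    where
    lem : ∀ q κ N → q ℚ.* (κ ℚ.* N) ≡ κ ℚ.* (q ℚ.* N)
    lem = RingSolver.solve-∀ ℚ-ring

  coefficient : ∀ i x y → q i ℚ.* fromℤ x ℚ.* fromℤ y ≡ κ ℚ.* fromℤ (+ Q i * x * y)
  coefficient i x y = begin
    q i ℚ.* fromℤ x ℚ.* fromℤ y                          ≡⟨ cong (λ z → z ℚ.* fromℤ x ℚ.* fromℤ y) (q≡κQ i) ⟩
    κ ℚ.* fromℕ (Q i) ℚ.* fromℤ x ℚ.* fromℤ y            ≡⟨ lem κ (fromℕ (Q i)) (fromℤ x) (fromℤ y) ⟩
    κ ℚ.* (fromℕ (Q i) ℚ.* fromℤ x ℚ.* fromℤ y)          ≡⟨ cong (λ z → κ ℚ.* (z ℚ.* fromℤ y)) (fromℤ-* (+ Q i) x) ⟨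
    κ ℚ.* (fromℤ (+ Q i * x) ℚ.* fromℤ y)                ≡⟨ cong (κ ℚ.*_) (fromℤ-* (+ Q i * x) y) ⟨
    κ ℚ.* fromℤ (+ Q i * x * y)                          ∎
    where
    open ≡-Reasoning
    lem : ∀ κ Q x y → κ ℚ.* Q ℚ.* x ℚ.* y ≡ κ ℚ.* (Q ℚ.* x ℚ.* y)
    lem = RingSolver.solve-∀ ℚ-ring

  -- The common coefficient of x y in the terms over ℚ, obtained by dividing the integer coefficient
  -- by N.
  q′ : ℚ
  q′ = κ ℚ.* fromℕ (A i₀)

  q′>0 : Positive q′
  q′>0 = ℚ.pos*pos⇒pos κ {{ℚ.1/pos⇒pos (fromℕ N)}} (fromℕ (A i₀)) {{fromℕ-positive (A i₀) (A≢0 i₀)}}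

  coeff-term : ∀ i x y → coeff (term i) x y ≡
    bilinear q′ (κ ℚ.* fromℤ (B i)) (κ ℚ.* fromℤ (C i)) (κ ℚ.* fromℤ (D i)) x y
  coeff-term i x y = trans (coeff-product (q i) (fromℕ (a i)) (fromℤ (n i)) (fromℕ (b i)) (fromℤ (m i)) x y)
    (trans (cong₂ (λ α β → bilinear α β (q i ℚ.* fromℤ (n i) ℚ.* fromℕ (b i)) (q i ℚ.* fromℤ (n i) ℚ.* fromℤ (m i)) x y)
              (trans (coefficient i (+ a i) (+ b i)) (cong (λ z → κ ℚ.* fromℤ z) (trans (sym (A-product i)) (cong +_ (A≡ i)))))
              (coefficient i (+ a i) (m i)))
           (cong₂ (λ γ δ → bilinear q′ (κ ℚ.* fromℤ (B i)) γ δ x y)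
              (coefficient i (n i) (+ b i)) (coefficient i (n i) (m i))))

  lookup-term : ∀ i → Vec.lookup (productPattern q a b n m) (suc (suc i)) ≡ term i
  lookup-term = Vec.lookup∘tabulate term

  distinct : ∀ i j → B i ≡ B j → C i ≡ C j → D i ≡ D j → i ≡ j
  distinct i j B≡ C≡ D≡ = Fin.suc-injective (Fin.suc-injective
    (cardinality⇒injective (productPattern q a b n m) cardinality (suc (suc i)) (suc (suc j)) λ x y →
      trans (cong (λ p → coeff p x y) (lookup-term i)) (trans (terms-≡ x y) (cong (λ p → coeff p x y) (sym (lookup-term j))))))
    where
    terms-≡ : term i ≈ term j
    terms-≡ x y = trans (coeff-term i x y) (trans
      (cong₂ (λ β γ → bilinear q′ (κ ℚ.* fromℤ β) (κ ℚ.* fromℤ γ) (κ ℚ.* fromℤ (D i)) x y) B≡ C≡)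
      (trans (cong (λ δ → bilinear q′ (κ ℚ.* fromℤ (B j)) (κ ℚ.* fromℤ (C j)) (κ ℚ.* fromℤ δ) x y) D≡)
             (sym (coeff-term j x y))))

  recurrent-level : Recurrent (+ N) (λ _ → + A i₀) B C D
  recurrent-level c M = record
    { u = u ; v = v ; w = w ; M<u = M<u ; M<v = M<v ; M<w = M<w ; v∼u = v∼u ; w∼u = w∼u
    ; eq = λ i → trans (eq i) (cong (λ α → + α * + u * + v + B i * + u + C i * + v + D i) (A≡ i)) }
    where open Hit (recurrent c M)

  open Classification k≥3 {+ N} {+ A i₀} (λ e → ℕ.≢-nonZero⁻¹ N (ℤ.+-injective e))
    (λ e → ℕ.≢-nonZero⁻¹ (A i₀) {{A≢0 i₀}} (ℤ.+-injective e)) {B} {C} {D}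
    (λ i → trans (cong (λ α → + α * D i) (sym (A≡ i))) (AD≡BC i))
    recurrent-level distinct
    using (shape; kind-injective; k≡3) public

  kindOf : Fin k → Fin 3
  kindOf i = kind {+ N} {B i} {C i} {D i} (shape i)

  coeff-kind : ∀ t x y → coeff (Vec.lookup (scaledPattern q′) (suc (suc t))) x y ≡
    bilinear q′ (κ ℚ.* fromℤ (proj₁ (slopes (+ N) t))) (κ ℚ.* fromℤ (proj₂ (slopes (+ N) t))) (κ ℚ.* 0ℚ) x y
  coeff-kind zero x y = trans (coeff-xy q′ x y) (cong (λ z → bilinear q′ z z z x y) (sym (ℚ.*-zeroʳ κ)))
  coeff-kind (suc zero) x y = trans (coeff-xy+x q′ x y)
    -- The integer slope N becomes the coefficient κ N = 1 of x after division by N.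
    (cong₂ (λ o z → bilinear q′ o z z x y) (sym κN≡1) (sym (ℚ.*-zeroʳ κ)))
  coeff-kind (suc (suc zero)) x y = trans (coeff-xy+y q′ x y)
    (cong₂ (λ o z → bilinear q′ z o z x y) (sym κN≡1) (sym (ℚ.*-zeroʳ κ)))

  term-kind : ∀ i → term i ≈ Vec.lookup (scaledPattern q′) (suc (suc (kindOf i)))
  term-kind i x y =
    let B≡ , C≡ , D≡0 = kind-slopes {+ N} {B i} {C i} {D i} (shape i)
    in trans (coeff-term i x y) (trans
         (cong₂ (λ β γ → bilinear q′ (κ ℚ.* fromℤ β) (κ ℚ.* fromℤ γ) (κ ℚ.* fromℤ (D i)) x y) B≡ C≡)
         (trans (cong (λ δ → bilinear q′ (κ ℚ.* fromℤ (proj₁ (slopes (+ N) (kindOf i)))) (κ ℚ.* fromℤ (proj₂ (slopes (+ N) (kindOf i)))) (κ ℚ.* fromℤ δ) x y) D≡0)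
                (sym (coeff-kind (kindOf i) x y))))

  position : Fin (2 +ℕ k) → Fin 5
  position zero          = zero
  position (suc zero)    = suc zero
  position (suc (suc i)) = suc (suc (kindOf i))

  position-injective : Injective _≡_ _≡_ position
  position-injective {zero}        {zero}        _  = refl
  position-injective {suc zero}    {suc zero}    _  = refl
  position-injective {zero}        {suc zero}    ()
  position-injective {zero}        {suc (suc _)} ()
  position-injective {suc zero}    {zero}        ()
  position-injective {suc zero}    {suc (suc _)} ()
  position-injective {suc (suc _)} {zero}        ()
  position-injective {suc (suc _)} {suc zero}    ()
  position-injective {suc (suc i)} {suc (suc j)} eq =
    cong (λ l → suc (suc l)) (kind-injective (Fin.suc-injective (Fin.suc-injective eq)))

  matches : ∀ i → Vec.lookup (productPattern q a b n m) i ≈ Vec.lookup (scaledPattern q′) (position i)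
  matches zero          x y = refl
  matches (suc zero)    x y = refl
  matches (suc (suc i)) x y = trans (cong (λ p → coeff p x y) (lookup-term i)) (term-kind i x y)

  same-up-to-order : SameUpToOrder (productPattern q a b n m) (scaledPattern q′)
  same-up-to-order = order (productPattern q a b n m) (scaledPattern q′) k≡3 position position-injective matches
    where
    order : ∀ {k} (ps : Vec Poly (2 +ℕ k)) (qs : Vec Poly 5) → k ≡ 3 → (f : Fin (2 +ℕ k) → Fin 5) →
      Injective _≡_ _≡_ f → (∀ i → Vec.lookup ps i ≈ Vec.lookup qs (f i)) → SameUpToOrder ps qs
    order ps qs refl f f-inj ps≈qs =
      let σ , σ≡f = injective⇒permutation f f-inj
      in σ , λ i x y → trans (ps≈qs i x y) (cong (λ l → coeff (Vec.lookup qs l) x y) (sym (σ≡f i)))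

corollaryE : ((k : ℕ) (q : Fin k → ℚ) (a b : Fin k → ℕ) (n m : Fin k → ℤ) →
    (∀ i → Positive (q i)) → (∀ i → NonZero (a i)) → (∀ i → NonZero (b i)) →
    HasCardinality ⟨ productPattern q a b n m ⟩ (2 +ℕ k) → 2 +ℕ k ≥ 5 →
    PolyPartitionRegular (productPattern q a b n m) →
    k ≡ 3 × (∃[ q′ ] Positive q′ × SameUpToOrder (productPattern q a b n m) (scaledPattern q′)))
    ×
    ((q : ℚ) → Positive q →
    PolyPartitionRegular (scaledPattern q) ⇔ PolyPartitionRegular unscaledPattern)
corollaryE =
  (λ k q a b n m q>0 a≢0 b≢0 cardinality 2+k≥5 pr →
     let open Pattern q a b n m q>0 a≢0 b≢0 (ℕ.+-cancelˡ-≤ 2 3 k 2+k≥5) cardinality pr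
     in k≡3 , q′ , q′>0 , same-up-to-order) ,
  scaled⇔unscaled
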